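{- The problem of counting Eulerian tours in 4-regular graphs is polynomial-time Turing reducible to the problem of counting A-trails in 4-regular maps. That is, there is a polynomial-time algorithm with access to an oracle that returns the number of A-trails of any given 4-regular map, which on input an arbitrary 4-regular graph $G$ outputs the number of Eulerian tours of $G$.
   Context: Graphs are finite and undirected; parallel edges and loops are allowed. A graph is 4-regular if every vertex has degree 4 (a loop contributes 2). An Eulerian tour is a closed trail that travels each edge exactly once; tours are counted up to the choice of starting point and direction, i.e. an Eulerian tour is identified with the choice, at every vertex, of a perfect matching ("pairing") of the edge-ends at that vertex such that following these pairings gives a single closed trail through all edges. A cyclic ordering $O^+(v)$ at a vertex $v$ of degree $d>0$ is an ordering $(e_1,\dots,e_d)$ of the edge-ends at $v$; $e_i$ and $e_{i+1}$ are called cyclicly-adjacent for $1\le i\le d$, where $e_{d+1}:=e_1$. A rotational embedding scheme of a graph is a choice of a cyclic ordering at each vertex; a map is a graph together with a rotational embedding scheme (no planarity is assumed). A 4-regular map is a map whose graph is 4-regular. An A-trail of a map is an Eulerian tour in which any two consecutive edges (including the last and the first), passing through a vertex $v$, are cyclicly-adjacent in $O^+(v)$; equivalently, at every vertex the pairing only pairs cyclicly-adjacent edge-ends. -}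

module Defs where

open import Data.Bool.Base using (if_then_else_; _∧_)
open import Data.Fin.Base using (Fin; toℕ; finToFun; quotient; remainder; combine; opposite)
open import Data.Fin.Properties using (all?) renaming (_≟_ to _≟F_)
open import Data.List.Base
  using (List; []; _∷_; _++_; [_]; map; concatMap; zip; length; filter; allFin; iterate)
open import Data.List.Membership.Propositional using (_∈_)
open import Data.List.Relation.Binary.Permutation.Propositional using (_↭_)
open import Data.List.Relation.Unary.Any using (any?)
open import Data.Nat.Base
  using (ℕ; zero; suc; _+_; _*_; _∸_; _/_; _%_; _^_; _≤_; _≡ᵇ_)
open import Data.Nat.GeneralisedArithmetic using (fold)
open import Data.Nat.ListAction using (sum)
open import Data.Nat.Logarithm using (⌊log₂_⌋)
open import Data.Product.Base using (Σ; ∃; ∃-syntax; _×_; _,_; proj₁)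
open import Data.Product.Properties using (≡-dec)
open import Data.Sum.Base using (_⊎_)
open import Relation.Binary.PropositionalEquality.Core using (_≡_; _≢_)
open import Relation.Nullary.Decidable using (Dec; _×-dec_; _⊎-dec_; ¬?)

-- Edge e has the two edge-ends combine e 0 and combine e 1, numbered 2e and
-- 2e + 1; a graph attaches every edge-end to a vertex.  Which of the two ends
-- is called 0 carries no meaning.
record Graph : Set where
  field
    #V #E  : ℕ
    vertex : Fin (#E * 2) → Fin #V

  Vertex Edge End : Set
  Vertex = Fin #V
  Edge   = Fin #E
  End    = Fin (#E * 2)

  edge : End → Edge
  edge = quotient 2

  otherEnd : End → End
  otherEnd h = combine (edge h) (opposite (remainder {#E} 2 h))

  endsAt : Vertex → List End
  endsAt v = filter (λ h → vertex h ≟F v) (allFin (#E * 2))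

  degree : Vertex → ℕ
  degree v = length (endsAt v)

  -- τ h is the edge-end paired with h.
  IsPairing : (End → End) → Set
  IsPairing τ = (∀ h → vertex (τ h) ≡ vertex h)
              × (∀ h → τ h ≢ h)
              × (∀ h → τ (τ h) ≡ h)

  -- Leave along the edge that starts with the end h, and continue with the
  -- end that is paired with the end of arrival.
  follow : (End → End) → End → End
  follow τ h = τ (otherEnd h)

  -- The first #E edges travelled from h.  If they include every edge, they
  -- include every edge exactly once.
  edgesFrom : (End → End) → End → List Edge
  edgesFrom τ h = map edge (iterate (follow τ) h #E)

  IsSingleClosedTrail : (End → End) → Set
  IsSingleClosedTrail τ =
    ∀ h → (fold h (follow τ) #E ≡ h) × (∀ e → e ∈ edgesFrom τ h)

  IsEulerianTour : (End → End) → Set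
  IsEulerianTour τ = IsPairing τ × IsSingleClosedTrail τ

  isEulerianTour? : ∀ τ → Dec (IsEulerianTour τ)
  isEulerianTour? τ =
    (all? (λ h → vertex (τ h) ≟F vertex h)
      ×-dec all? (λ h → ¬? (τ h ≟F h))
      ×-dec all? (λ h → τ (τ h) ≟F h))
    ×-dec all? (λ h → (fold h (follow τ) #E ≟F h)
      ×-dec all? (λ e → any? (e ≟F_) (edgesFrom τ h)))

_-Regular : ℕ → Graph → Set
(d -Regular) G = ∀ v → Graph.degree G v ≡ d

-- For (e₁ , … , e_d): the pairs (e₁ , e₂) , … , (e_{d-1} , e_d) , (e_d , e₁).
successivePairs : ∀ {A : Set} → List A → List (A × A)
successivePairs []       = []
successivePairs (x ∷ xs) = zip (x ∷ xs) (xs ++ [ x ])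

CyclicallyAdjacent : ∀ {A : Set} → List A → A → A → Set
CyclicallyAdjacent xs a b = (a , b) ∈ successivePairs xs ⊎ (b , a) ∈ successivePairs xs

record RotationMap : Set where
  field
    graph : Graph
  open Graph graph public
  field
    ordering   : Vertex → List End
    ordering-↭ : ∀ v → ordering v ↭ endsAt v

  IsATrail : (End → End) → Set
  IsATrail τ = IsEulerianTour τ
             × (∀ h → CyclicallyAdjacent (ordering (vertex h)) h (τ h))

  isATrail? : ∀ τ → Dec (IsATrail τ)
  isATrail? τ = isEulerianTour? τ ×-dec all? (λ h →
    any? (≡-dec _≟F_ _≟F_ (h , τ h)) (successivePairs (ordering (vertex h)))
    ⊎-dec any? (≡-dec _≟F_ _≟F_ (τ h , h)) (successivePairs (ordering (vertex h))))

-- The number of functions Fin m → Fin n satisfying P.  finToFun enumerates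
-- them without repetition up to pointwise equality.
#functions : ∀ {m n} {P : (Fin m → Fin n) → Set} → (∀ f → Dec (P f)) → ℕ
#functions {m} {n} P? = length (filter (λ c → P? (finToFun c)) (allFin (n ^ m)))

#EulerianTours : Graph → ℕ
#EulerianTours G = #functions (Graph.isEulerianTour? G)

#ATrails : RotationMap → ℕ
#ATrails M = #functions (RotationMap.isATrail? M)

record CountingProblem : Set₁ where
  field
    Instance : Set
    encode   : Instance → List ℕ
    count    : Instance → ℕ

encodeGraph : Graph → List ℕ
encodeGraph G = #V ∷ #E ∷ map (λ h → toℕ (vertex h)) (allFin (#E * 2))
  where open Graph G

encodeMap : RotationMap → List ℕ
encodeMap M = encodeGraph graph
           ++ concatMap (λ v → length (ordering v) ∷ map toℕ (ordering v)) (allFin #V)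
  where open RotationMap M

EulerianToursIn4RegularGraphs : CountingProblem
EulerianToursIn4RegularGraphs = record
  { Instance = Σ Graph (4 -Regular)
  ; encode   = λ (G , _) → encodeGraph G
  ; count    = λ (G , _) → #EulerianTours G
  }

ATrailsIn4RegularMaps : CountingProblem
ATrailsIn4RegularMaps = record
  { Instance = Σ RotationMap (λ M → (4 -Regular) (RotationMap.graph M))
  ; encode   = λ (M , _) → encodeMap M
  ; count    = λ (M , _) → #ATrails M
  }

-- Programs describe a structured random access machine under the logarithmic
-- cost criterion, which is polynomially equivalent to oracle Turing machines.
-- Memory consists of arrays of natural numbers; the names of
-- arrays are fixed in the program text, indices are computed.
-- Input size is measured in binary digits as well.

-- Number of binary digits (1 for the number 0).
‖_‖ : ℕ → ℕ
‖ n ‖ = suc ⌊log₂ n ⌋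

‖_‖* : List ℕ → ℕ
‖ xs ‖* = sum (map ‖_‖ xs)

data Op : Set where
  add sub mul div mod : Op

-- Subtraction is truncated.
⟦_⟧ : Op → ℕ → ℕ → ℕ
⟦ add ⟧ m n       = m + n
⟦ sub ⟧ m n       = m ∸ n
⟦ mul ⟧ m n       = m * n
⟦ div ⟧ m zero    = 0
⟦ div ⟧ m (suc n) = m / suc n
⟦ mod ⟧ m zero    = m
⟦ mod ⟧ m (suc n) = m % suc n

data Expr : Set where
  lit : ℕ → Expr
  get : (array : ℕ) (index : Expr) → Expr
  op  : Op → Expr → Expr → Expr

infixr 5 _⨾_

data Program : Set where
  skip   : Program
  _⨾_    : Program → Program → Program
  set    : (array : ℕ) (index value : Expr) → Program
  ifnz   : (cond : Expr) (then else : Program) → Program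
  while  : (cond : Expr) (body : Program) → Program
  -- Append a number to the query under construction.
  emit   : (value : Expr) → Program
  -- Submit the query, store the answer, and start a new empty query.
  ask    : (array : ℕ) (index : Expr) → Program

Memory : Set
Memory = ℕ → ℕ → ℕ

record State : Set where
  constructor ⟨_,_⟩
  field
    memory : Memory
    query  : List ℕ

write : ℕ → ℕ → ℕ → Memory → Memory
write a i v μ b j = if (a ≡ᵇ b) ∧ (i ≡ᵇ j) then v else μ b j

eval : Memory → Expr → ℕ
eval μ (lit n)     = n
eval μ (get a e)   = μ a (eval μ e)
eval μ (op o e e′) = ⟦ o ⟧ (eval μ e) (eval μ e′)

-- Every number that is read or computed is charged for its length.
cost : Memory → Expr → ℕ
cost μ (lit n)     = ‖ n ‖
cost μ (get a e)   = cost μ e + ‖ μ a (eval μ e) ‖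
cost μ (op o e e′) = cost μ e + cost μ e′ + ‖ ⟦ o ⟧ (eval μ e) (eval μ e′) ‖

Oracle : Set
Oracle = List ℕ → ℕ

-- O ⊢ p , s ⇓ s′ [ t ]: with oracle O, the program p started in state s halts
-- in state s′ after time t.
data _⊢_,_⇓_[_] (O : Oracle) : Program → State → State → ℕ → Set where
  ⇓skip : ∀ {s} → O ⊢ skip , s ⇓ s [ 1 ]
  ⇓seq : ∀ {p q s s′ s″ t t′} →
    O ⊢ p , s ⇓ s′ [ t ] →
    O ⊢ q , s′ ⇓ s″ [ t′ ] →
    O ⊢ p ⨾ q , s ⇓ s″ [ t + t′ ]
  ⇓set : ∀ {a i e μ q} →
    O ⊢ set a i e , ⟨ μ , q ⟩ ⇓ ⟨ write a (eval μ i) (eval μ e) μ , q ⟩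
      [ cost μ i + cost μ e ]
  ⇓then : ∀ {e p p′ μ q s′ t} →
    eval μ e ≢ 0 →
    O ⊢ p , ⟨ μ , q ⟩ ⇓ s′ [ t ] →
    O ⊢ ifnz e p p′ , ⟨ μ , q ⟩ ⇓ s′ [ cost μ e + t ]
  ⇓else : ∀ {e p p′ μ q s′ t} →
    eval μ e ≡ 0 →
    O ⊢ p′ , ⟨ μ , q ⟩ ⇓ s′ [ t ] →
    O ⊢ ifnz e p p′ , ⟨ μ , q ⟩ ⇓ s′ [ cost μ e + t ]
  ⇓stop : ∀ {e p μ q} →
    eval μ e ≡ 0 →
    O ⊢ while e p , ⟨ μ , q ⟩ ⇓ ⟨ μ , q ⟩ [ cost μ e ]
  ⇓loop : ∀ {e p μ q s′ s″ t t′} →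
    eval μ e ≢ 0 →
    O ⊢ p , ⟨ μ , q ⟩ ⇓ s′ [ t ] →
    O ⊢ while e p , s′ ⇓ s″ [ t′ ] →
    O ⊢ while e p , ⟨ μ , q ⟩ ⇓ s″ [ cost μ e + t + t′ ]
  ⇓emit : ∀ {e μ q} →
    O ⊢ emit e , ⟨ μ , q ⟩ ⇓ ⟨ μ , q ++ [ eval μ e ] ⟩ [ cost μ e ]
  ⇓ask : ∀ {a i μ q} →
    O ⊢ ask a i , ⟨ μ , q ⟩ ⇓ ⟨ write a (eval μ i) (O q) μ , [] ⟩
      [ cost μ i + ‖ q ‖* + ‖ O q ‖ ]

nth : List ℕ → ℕ → ℕ
nth []       _       = 0
nth (x ∷ xs) zero    = x
nth (x ∷ xs) (suc i) = nth xs i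

-- The input is array 0; all other cells are 0.
initial : List ℕ → State
initial xs = ⟨ μ , [] ⟩
  where
  μ : Memory
  μ zero    i = nth xs i
  μ (suc a) i = 0

output : State → ℕ
output s = State.memory s 1 0

-- Nothing is assumed about the answers to queries that encode no instance.
_Solves_ : Oracle → CountingProblem → Set
O Solves B = ∀ y → O (encode y) ≡ count y
  where open CountingProblem B

PolynomiallyBounded : (ℕ → ℕ) → Set
PolynomiallyBounded f = ∃[ c ] ∃[ k ] ∀ n → f n ≤ c * n ^ k + c

infix 4 _≤ᵖᵀ_

_≤ᵖᵀ_ : CountingProblem → CountingProblem → Set
A ≤ᵖᵀ B =
  ∃[ p ] ∃[ T ] PolynomiallyBounded T ×
    (∀ O → O Solves B →
     ∀ x → ∃[ s ] ∃[ t ]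
       (O ⊢ p , initial (encode x) ⇓ s [ t ])
       × (t ≤ T ‖ encode x ‖*)
       × (output s ≡ count x))
  where open CountingProblem A

{-# OPTIONS --safe #-}
module Submission where

-- Replace every vertex v of G by the following gadget with three vertices of
-- degree 4, where a, c, e, f are the edge-ends at v and m, n, b, d are new edges:
--   x = (a, b, n, m),   y = (c, d, n, m),   z = (b, e, d, f)   in cyclic order.
-- In an A-trail each gadget vertex has two possible pairings.  Of the eight
-- states of the gadget, the two in which both x and y pair m with n close the
-- circle m n; each of the three pairings of a, c, e, f arises from exactly two
-- of the other six.  Hence the new map has 2 ^ #V times as many A-trails as G has
-- Eulerian tours, and a single query suffices.  That a pairing is a single closed
-- trail means that all edge-ends are connected by steps along edges and pairings,
-- and this connectivity passes through the gadgets in both directions.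

open import Defs
open import Data.Bool.Base using (T; _∧_; false; true)
open import Data.Fin.Base as Fin
  using (Fin; _↑ʳ_; _↑ˡ_; combine; finToFun; fromℕ<; funToFin; opposite; quotient; remainder;
         splitAt; toℕ)
open import Data.Fin.Patterns using (0F; 1F; 2F; 3F; 4F; 5F; 6F; 7F)
import Data.Fin.Properties as Fin
open import Data.List.Base
  using (List; []; [_]; _++_; _∷_; allFin; cartesianProduct; concat; concatMap; drop; filter;
         foldr; iterate; length; lookup; map; tabulate; take)
open import Data.List.Membership.Propositional using (_∈_)
open import Data.List.Membership.Propositional.Properties
  using (∈-++⁺ʳ; ∈-allFin; ∈-cartesianProduct⁺; ∈-cartesianProduct⁻; ∈-filter⁺; ∈-filter⁻;
         ∈-lookup; ∈-map⁺; ∈-map⁻)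
open import Data.List.Membership.Propositional.Properties.WithK using (unique∧set⇒bag)
import Data.List.Properties as List
open import Data.List.Relation.Binary.BagAndSetEquality using (∼bag⇒↭)
open import Data.List.Relation.Binary.Permutation.Propositional.Properties using (↭-length)
import Data.List.Relation.Unary.All as All
open import Data.List.Relation.Unary.AllPairs using ([]; _∷_)
open import Data.List.Relation.Unary.Any using (here; index; there)
open import Data.List.Relation.Unary.Any.Properties using (lookup-index)
open import Data.List.Relation.Unary.Unique.Propositional using (Unique)
import Data.List.Relation.Unary.Unique.Propositional.Properties as Unique
open import Data.Nat.Base
  using (NonZero; _*_; _+_; _/_; _<_; _^_; _∸_; _≡ᵇ_; _≤_; suc; s≤s; s≤s⁻¹; zero; z≤n; ℕ)
import Data.Nat.DivMod as ℕ
open import Data.Nat.GeneralisedArithmetic using (fold; fold-+)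
open import Data.Nat.ListAction using (sum)
open import Data.Nat.ListAction.Properties using (sum-++)
open import Data.Nat.Logarithm using (⌊log₂[2^n]⌋≡n; ⌊log₂⌋-mono-≤)
import Data.Nat.Properties as ℕ
open import Data.Product.Base using (_,_; _×_; proj₁; proj₂; Σ; ∃-syntax)
open import Data.Product.Properties using (,-injectiveʳ; ,-injectiveˡ)
open import Data.Sum.Base using (_⊎_; inj₁; inj₂)
import Data.Sum.Properties as Sum
open import Function.Base using (_∘_; id)
open import Function.Bundles using (mk⇔)
open import Relation.Binary.Construct.Closure.ReflexiveTransitive
  using (Star; _◅_; _◅◅_; return; reverse; ε)
open import Relation.Binary.PropositionalEquality hiding ([_])
open import Relation.Nullary.Decidable using (Dec; _→-dec_; from-yes; no; yes; ¬?)
open import Relation.Nullary.Negation.Core using (contradiction; ¬_)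

-- An A-trail may not match opposite positions, so a vertex of a map offers only two of the three
-- matchings available at a vertex of `G`. A substitute for the vertex has to realize all three
-- equally often: only then is the factor the same for every tour, so that a division recovers the
-- number of tours. Following trails through the gadgets would mean relating iterates of `follow` in
-- two graphs in which the number of edges and the directions of travel differ. Connectivity forgets
-- both. It suffices because the orbit of an end never contains its other end, so that each edge is
-- travelled once per period. The machine charges for digits. Hence the power of two and the answer
-- of the oracle must have polynomially many digits, and `#V`, which the input gives in binary, must
-- be polynomial in the input size.

lookup-injective : ∀ {A : Set} {xs : List A} → Unique xs →
  ∀ {i j} → lookup xs i ≡ lookup xs j → i ≡ j
lookup-injective (_ ∷ _)  {Fin.zero}  {Fin.zero}  _  = refl
lookup-injective (x∉ ∷ _) {Fin.zero}  {Fin.suc j} eq = contradiction eq (All.lookup x∉ (∈-lookup j))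
lookup-injective (x∉ ∷ _) {Fin.suc i} {Fin.zero}  eq = contradiction (sym eq)
    (All.lookup x∉ (∈-lookup i))
lookup-injective (_ ∷ u)  {Fin.suc i} {Fin.suc j} eq = cong Fin.suc (lookup-injective u eq)

-- Pigeonhole: if `xs` were longer, two of its positions would be related to the same position of
-- `ys`. Applied to a relation and to its converse, it gives equal lengths without an inverse
-- function.
related-length-≤ : ∀ {A B : Set} (R : A → B → Set) {xs ys} → Unique xs →
  (∀ {x} → x ∈ xs → ∃[ y ] y ∈ ys × R x y) →
  (∀ {x x′ y} → R x y → R x′ y → x ≡ x′) →
  length xs ≤ length ys
related-length-≤ R {xs} {ys} unique total injective = ℕ.≮⇒≥ λ ys<xs →
  let i , j , i<j , eq = Fin.pigeonhole ys<xs image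
      Rⱼ = subst (λ k → R (lookup xs j) (lookup ys k)) (sym eq) (R-image j)
  in Fin.<⇒≢ i<j (lookup-injective unique (injective (R-image i) Rⱼ))
  where
  image : Fin (length xs) → Fin (length ys)
  image i = index (proj₁ (proj₂ (total (∈-lookup i))))
  R-image : ∀ i → R (lookup xs i) (lookup ys (image i))
  R-image i with y , y∈ys , r ← total (∈-lookup {xs = xs} i) = subst (R _) (lookup-index y∈ys) r

fold-suc : ∀ {A : Set} (f : A → A) x k → fold (f x) f k ≡ f (fold x f k)
fold-suc f x zero    = refl
fold-suc f x (suc k) = cong f (fold-suc f x k)

∈-iterate⁺ : ∀ {A : Set} (f : A → A) x {n k} → k < n → fold x f k ∈ iterate f x n
∈-iterate⁺ f x {suc n} {zero}  _         = here refl
∈-iterate⁺ f x {suc n} {suc k} (s≤s k<n) =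
  there (subst (_∈ _) (fold-suc f x k) (∈-iterate⁺ f (f x) k<n))

∈-iterate⁻ : ∀ {A : Set} (f : A → A) x n {y} → y ∈ iterate f x n → ∃[ k ] y ≡ fold x f k
∈-iterate⁻ f x (suc n) (here eq) = 0 , eq
∈-iterate⁻ f x (suc n) (there y∈) with k , eq ← ∈-iterate⁻ f (f x) n y∈ = suc k , trans eq
    (fold-suc f x k)

-- Eulerian tours as connected pairings

module Connectivity (G : Graph) where
  open Graph G

  Step : (End → End) → End → End → Set
  Step τ x y = y ≡ otherEnd x ⊎ y ≡ τ x

  Connected : (End → End) → Set
  Connected τ = ∀ x y → Star (Step τ) x y

  edge-combine : ∀ (e : Edge) (r : Fin 2) → edge (combine e r) ≡ e
  edge-combine e r = cong proj₁ (Fin.remQuot-combine e r)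

  end-combine : ∀ h → combine (edge h) (remainder {#E} 2 h) ≡ h
  end-combine = Fin.combine-remQuot {#E} 2

  otherEnd-combine : ∀ (e : Edge) (r : Fin 2) → otherEnd (combine e r) ≡ combine e (opposite r)
  otherEnd-combine e r = cong₂ (λ e r → combine e (opposite r))
    (cong proj₁ (Fin.remQuot-combine e r)) (cong proj₂ (Fin.remQuot-combine e r))

  edge-otherEnd : ∀ h → edge (otherEnd h) ≡ edge h
  edge-otherEnd h = edge-combine _ _

  otherEnd-involutive : ∀ h → otherEnd (otherEnd h) ≡ h
  otherEnd-involutive h = trans (otherEnd-combine _ _)
    (trans (cong (combine (edge h)) (Fin.opposite-involutive _)) (end-combine h))

  otherEnd-≢ : ∀ h → otherEnd h ≢ h
  otherEnd-≢ h eq = opposite-≢ _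
    (Fin.combine-injectiveʳ (edge h) _ (edge h) _ (trans eq (sym (end-combine h))))
    where
    opposite-≢ : ∀ (r : Fin 2) → opposite r ≢ r
    opposite-≢ 0F ()
    opposite-≢ 1F ()

  sameEdge : ∀ {x y} → edge x ≡ edge y → x ≡ y ⊎ x ≡ otherEnd y
  sameEdge {x} {y} eq
    with remainder {#E} 2 x | end-combine x | remainder {#E} 2 y | end-combine y
  ... | 0F | p | 0F | q = inj₁ (trans (sym p) (trans (cong (λ e → combine e 0F) eq) q))
  ... | 1F | p | 1F | q = inj₁ (trans (sym p) (trans (cong (λ e → combine e 1F) eq) q))
  ... | 0F | p | 1F | q = inj₂ (trans (sym p) (cong (λ e → combine e 0F) eq))
  ... | 1F | p | 0F | q = inj₂ (trans (sym p) (cong (λ e → combine e 1F) eq))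

  travel : ∀ {τ x} k → Star (Step τ) x (fold x (follow τ) k)
  travel zero    = ε
  travel (suc k) = travel k ◅◅ inj₁ refl ◅ inj₂ refl ◅ ε

  -- The trail from `x` lists the edge of `y`, so its orbit contains `y` or the other end of `y`; in
  -- the second case one more step along the edge reaches `y`.
  trail⇒connected : ∀ {τ} → IsSingleClosedTrail τ → Connected τ
  trail⇒connected {τ} trail x y
    with z , z∈ , eq ← ∈-map⁻ edge (proj₂ (trail x) (edge y))
    with k , refl ← ∈-iterate⁻ (follow τ) x #E z∈
    with sameEdge eq
  ... | inj₁ refl = travel k
  ... | inj₂ refl = travel k ◅◅ inj₁ refl ◅ ε

  module _ {τ} (τ-pairing : IsPairing τ) where
    private
      σ : End → End
      σ = follow τ

    pairing-≢ : ∀ h → τ h ≢ h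
    pairing-≢ = proj₁ (proj₂ τ-pairing)

    pairing-involutive : ∀ h → τ (τ h) ≡ h
    pairing-involutive = proj₂ (proj₂ τ-pairing)

    follow⁻¹ : ∀ {x y} → σ x ≡ y → x ≡ otherEnd (τ y)
    follow⁻¹ {x} refl = sym (trans (cong otherEnd (pairing-involutive _)) (otherEnd-involutive x))

    follow-injective : ∀ {x y} → σ x ≡ σ y → x ≡ y
    follow-injective eq = trans (follow⁻¹ eq) (sym (follow⁻¹ refl))

    -- The orbits of x and of its other end run through the same edges in
    -- opposite directions, so if they were equal, they would meet in the
    -- middle, at a fixed point of otherEnd or of τ.
    follow-≢-otherEnd : ∀ k x → fold x σ k ≢ otherEnd x
    follow-≢-otherEnd 0             x eq = otherEnd-≢ x (sym eq)
    follow-≢-otherEnd 1             x eq = pairing-≢ _ eq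
    follow-≢-otherEnd (suc (suc k)) x eq = follow-≢-otherEnd k (σ x)
      (trans (fold-suc σ x k) (follow⁻¹ eq))

    edge-period : ∀ k x → edge (fold x σ k) ≡ edge x → fold x σ k ≡ x
    edge-period k x eq with sameEdge eq
    ... | inj₁ eq′ = eq′
    ... | inj₂ eq′ = contradiction eq′ (follow-≢-otherEnd k x)

    fold-cancel : ∀ k p x → fold x σ (p + k) ≡ fold x σ k → fold x σ p ≡ x
    fold-cancel zero    p x eq = trans (cong (fold x σ) (sym (ℕ.+-identityʳ p))) eq
    fold-cancel (suc k) p x eq = fold-cancel k p x
      (follow-injective (trans (cong (fold x σ) (sym (ℕ.+-suc p k))) eq))

    -- The pigeonhole is applied to the edges of the first `#E` + 1 ends of the orbit rather than to
    -- the ends: there are twice as many ends, and the period must not exceed `#E`. By `edge-period`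
    -- a repeated edge is a repeated end, and `follow` can be cancelled.
    period : ∀ x → ∃[ p ] suc p ≤ #E × fold x σ (suc p) ≡ x
    period x with i , j , i<j , eq ← Fin.pigeonhole (ℕ.n<1+n #E) (λ i → edge (fold x σ (toℕ i)))
      with p , eq′ ← ℕ.m≤n⇒∃[o]m+o≡n i<j
      rewrite sym eq′ = p , bound , fold-cancel (toℕ i) (suc p) x
        (trans (fold-+ x σ (suc p))
          (edge-period (suc p) _ (trans (cong edge (sym (fold-+ x σ (suc p))))
            (trans (cong (edge ∘ fold x σ) shuffle) (sym eq)))))
      where
      shuffle : suc p + toℕ i ≡ suc (toℕ i) + p
      shuffle = cong suc (ℕ.+-comm p (toℕ i))
      bound : suc p ≤ #E
      bound = ℕ.≤-trans (s≤s (ℕ.m≤n+m p (toℕ i))) (ℕ.≤-trans (ℕ.≤-reflexive eq′)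
          (s≤s⁻¹ (Fin.toℕ<n j)))

    module _ (connected : Connected τ) (x : End) (p : ℕ)
             (p<E : suc p ≤ #E) (returns : fold x σ (suc p) ≡ x) where
      OnTrail : End → Set
      OnTrail y = ∃[ k ] k < suc p × (y ≡ fold x σ k ⊎ y ≡ otherEnd (fold x σ k))

      -- `τ` is the second half of `follow`: it leads from an end of the orbit back to the other end
      -- of its predecessor, and from the other end of an orbit member forward to the successor. At
      -- the two limits of the index range `returns` closes the orbit.
      onTrail-step : ∀ {y z} → Step τ y z → OnTrail y → OnTrail z
      onTrail-step (inj₁ refl) (k , k≤p , inj₁ refl) = k , k≤p , inj₂ refl
      onTrail-step (inj₁ refl) (k , k≤p , inj₂ refl) = k , k≤p , inj₁ (otherEnd-involutive _)
      onTrail-step (inj₂ refl) (zero , _ , inj₁ refl) =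
        p , ℕ.≤-refl , inj₂ (trans (cong τ (sym returns)) (pairing-involutive _))
      onTrail-step (inj₂ refl) (suc k , k≤p , inj₁ refl) =
        k , ℕ.<-trans (ℕ.n<1+n k) k≤p , inj₂ (pairing-involutive _)
      onTrail-step (inj₂ refl) (k , k≤p , inj₂ refl) with suc k ℕ.<? suc p
      ... | yes k<p = suc k , k<p , inj₁ refl
      ... | no  k≮p with refl ← ℕ.≤-antisym k≤p (ℕ.≮⇒≥ k≮p) = 0 , s≤s z≤n , inj₁ returns

      onTrail-path : ∀ {y z} → Star (Step τ) y z → OnTrail y → OnTrail z
      onTrail-path ε        on = on
      onTrail-path (s ◅ ss) on = onTrail-path ss (onTrail-step s on)

      edge-onTrail : ∀ e → ∃[ k ] k < suc p × e ≡ edge (fold x σ k)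
      edge-onTrail e
        with onTrail-path (connected x (combine e 0F)) (0 , s≤s z≤n , inj₁ refl)
      ... | k , k≤p , inj₁ eq = k , k≤p , trans (sym (edge-combine e 0F)) (cong edge eq)
      ... | k , k≤p , inj₂ eq =
        k , k≤p , trans (sym (edge-combine e 0F)) (trans (cong edge eq) (edge-otherEnd _))

      -- Edges with the same index on the orbit are equal, so the `#E` edges need at least `#E`
      -- indices below the period.
      period≡#E : suc p ≡ #E
      period≡#E = ℕ.≤-antisym p<E (ℕ.≮⇒≥ λ p≪E →
        let i , j , i<j , eq = Fin.pigeonhole p≪E (λ e → fromℕ< (proj₁ (proj₂ (edge-onTrail e))))
            k≡k′ = Fin.fromℕ<-injective _ _ _ _ eq
        in Fin.<⇒≢ i<j (trans (proj₂ (proj₂ (edge-onTrail i)))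
             (trans (cong (edge ∘ fold x σ) k≡k′) (sym (proj₂ (proj₂ (edge-onTrail j)))))))

      closedTrail : fold x σ #E ≡ x × (∀ e → e ∈ edgesFrom τ x)
      closedTrail = subst (λ n → fold x σ n ≡ x) period≡#E returns , λ e →
        let k , k≤p , eq = edge-onTrail e in
        subst (_∈ _) (sym eq) (∈-map⁺ edge (∈-iterate⁺ σ x (subst (k <_) period≡#E k≤p)))

    connected⇒tour : Connected τ → IsEulerianTour τ
    connected⇒tour connected = τ-pairing , λ x →
      let p , p<E , returns = period x in closedTrail connected x p p<E returns

  -- Pointwise equal functions need not be propositionally equal, so the property is carried over
  -- through connectivity, where each step is corrected separately.
  tour-resp-≗ : ∀ {τ τ′} → τ ≗ τ′ → IsEulerianTour τ → IsEulerianTour τ′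
  tour-resp-≗ {τ} {τ′} eq ((at , noFix , inv) , trail) = connected⇒tour
    ( (λ h → trans (cong vertex (sym (eq h))) (at h))
    , (λ h eq′ → noFix h (trans (eq h) eq′))
    , (λ h → trans (sym (trans (cong τ (eq h)) (eq _))) (inv h)))
    (λ x y → path (trail⇒connected trail x y))
    where
    path : ∀ {x y} → Star (Step τ) x y → Star (Step τ′) x y
    path ε = ε
    path (inj₁ e ◅ ss) = inj₁ e ◅ path ss
    path (inj₂ e ◅ ss) = inj₂ (trans e (eq _)) ◅ path ss

-- Perfect matchings of four ends

pairing4 : Fin 3 → Fin 4 → Fin 4
pairing4 0F 0F = 1F
pairing4 0F 1F = 0F
pairing4 0F 2F = 3F
pairing4 0F 3F = 2F
pairing4 1F 0F = 3F
pairing4 1F 1F = 2F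
pairing4 1F 2F = 1F
pairing4 1F 3F = 0F
pairing4 2F 0F = 2F
pairing4 2F 1F = 3F
pairing4 2F 2F = 0F
pairing4 2F 3F = 1F

pairing4-≢ : ∀ k i → pairing4 k i ≢ i
pairing4-≢ = from-yes (Fin.all? λ k → Fin.all? λ i → ¬? (pairing4 k i Fin.≟ i))

pairing4-involutive : ∀ k i → pairing4 k (pairing4 k i) ≡ i
pairing4-involutive = from-yes (Fin.all? λ k → Fin.all? λ i → pairing4 k (pairing4 k i) Fin.≟ i)

pairing4-injective : ∀ k l → pairing4 k 0F ≡ pairing4 l 0F → k ≡ l
pairing4-injective = from-yes (Fin.all? λ k → Fin.all? λ l →
  (pairing4 k 0F Fin.≟ pairing4 l 0F) →-dec (k Fin.≟ l))

-- The partner of 0 already decides the matching. One further value is inspected to exclude a fixed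
-- point or a partner already taken; the involution supplies the rest.
pairing4-complete : (f : Fin 4 → Fin 4) → (∀ i → f i ≢ i) → (∀ i → f (f i) ≡ i) →
  ∃[ k ] f ≗ pairing4 k
pairing4-complete f noFix inv = go (f 0F) refl (f 1F) refl (f 2F) refl (f 3F) refl
  where
  back : ∀ {i j} → f i ≡ j → f j ≡ i
  back {i} refl = inv i
  clash : ∀ {A : Set} {i j k} → f i ≡ k → f j ≡ k → i ≢ j → A
  clash p q i≢j = contradiction (trans (sym (back p)) (back q)) i≢j
  go : ∀ a → f 0F ≡ a → ∀ b → f 1F ≡ b → ∀ c → f 2F ≡ c → ∀ d → f 3F ≡ d → ∃[ k ] f ≗ pairing4 k
  go 0F p b q c r d s = contradiction p (noFix 0F)
  go 1F p b q 2F r d s = contradiction r (noFix 2F)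
  go 1F p b q 0F r d s = clash (back p) r λ ()
  go 1F p b q 1F r d s = clash p r λ ()
  go 1F p b q 3F r d s = 0F , λ { 0F → p ; 1F → back p ; 2F → r ; 3F → back r }
  go 2F p 0F q c r d s = clash (back p) q λ ()
  go 2F p 1F q c r d s = contradiction q (noFix 1F)
  go 2F p 2F q c r d s = clash p q λ ()
  go 2F p 3F q c r d s = 2F , λ { 0F → p ; 1F → q ; 2F → back p ; 3F → back q }
  go 3F p 0F q c r d s = clash (back p) q λ ()
  go 3F p 1F q c r d s = contradiction q (noFix 1F)
  go 3F p 2F q c r d s = 1F , λ { 0F → p ; 1F → q ; 2F → back q ; 3F → back p }
  go 3F p 3F q c r d s = clash p q λ ()

-- Coordinates for the ends of a 4-regular graph, in which a pairing becomes a choice among three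
-- matchings at every vertex. For the given graph they come from the order of the ends in the input,
-- for the gadget graph from its cyclic orders.
record FourSlots (G : Graph) : Set where
  open Graph G
  field
    slot        : Vertex → Fin 4 → End
    rank        : End → Fin 4
    slot-rank   : ∀ h → slot (vertex h) (rank h) ≡ h
    vertex-slot : ∀ v i → vertex (slot v i) ≡ v
    rank-slot   : ∀ v i → rank (slot v i) ≡ i

  open Connectivity G public

  slot-injective : ∀ v {i j} → slot v i ≡ slot v j → i ≡ j
  slot-injective v {i} {j} eq = trans (sym (rank-slot v i)) (trans (cong rank eq) (rank-slot v j))

  pairingOf : (Vertex → Fin 3) → End → End
  pairingOf s h = slot (vertex h) (pairing4 (s (vertex h)) (rank h))

  pairingOf-slot : ∀ s v i → pairingOf s (slot v i) ≡ slot v (pairing4 (s v) i)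
  pairingOf-slot s v i = cong₂ (λ v i → slot v (pairing4 (s v) i)) (vertex-slot v i) (rank-slot v i)

  pairingOf-isPairing : ∀ s → IsPairing (pairingOf s)
  pairingOf-isPairing s =
      (λ h → vertex-slot _ _)
    , (λ h eq → pairing4-≢ (s (vertex h)) (rank h) (trans (sym (rank-slot _ _)) (cong rank eq)))
    , λ h → trans (pairingOf-slot s _ _)
        (trans (cong (slot (vertex h)) (pairing4-involutive (s (vertex h)) (rank h))) (slot-rank h))

  pairingOf-injective : ∀ {s s′} → pairingOf s ≗ pairingOf s′ → s ≗ s′
  pairingOf-injective {s} {s′} eq v = pairing4-injective (s v) (s′ v) (slot-injective v
    (trans (sym (pairingOf-slot s v 0F)) (trans (eq (slot v 0F)) (pairingOf-slot s′ v 0F))))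

  pairingOf-complete : ∀ {τ} → IsPairing τ → ∃[ s ] τ ≗ pairingOf s
  pairingOf-complete {τ} (at , noFix , inv) = (λ v → proj₁ (local v)) , λ h →
    trans (cong τ (sym (slot-rank h)))
      (trans (sym (τ-slot (vertex h) (rank h)))
          (cong (slot (vertex h)) (proj₂ (local (vertex h)) (rank h))))
    where
    τ-slot : ∀ v i → slot v (rank (τ (slot v i))) ≡ τ (slot v i)
    τ-slot v i = trans (cong (λ v′ → slot v′ (rank (τ (slot v i))))
      (sym (trans (at (slot v i)) (vertex-slot v i)))) (slot-rank _)
    local : ∀ v → ∃[ k ] (λ i → rank (τ (slot v i))) ≗ pairing4 k
    local v = pairing4-complete _
      (λ i eq → noFix (slot v i) (trans (sym (τ-slot v i)) (cong (slot v) eq)))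
      (λ i → trans (cong (rank ∘ τ) (τ-slot v i)) (trans (cong rank (inv (slot v i)))
          (rank-slot v i)))

  tour⇒choice : ∀ {τ} → IsEulerianTour τ → ∃[ s ] τ ≗ pairingOf s × Connected (pairingOf s)
  tour⇒choice tour with s , eq ← pairingOf-complete (proj₁ tour) =
    s , eq , trail⇒connected (proj₂ (tour-resp-≗ eq tour))

  choice⇒tour : ∀ {τ s} → pairingOf s ≗ τ → Connected (pairingOf s) → IsEulerianTour τ
  choice⇒tour {s = s} eq connected =
    tour-resp-≗ eq (connected⇒tour (pairingOf-isPairing s) connected)

-- The slots follow the order of `endsAt`, that is, increasing end numbers, so that a program
-- reading the ends in this order finds the rank of an end by counting.
fourSlots : ∀ G → (4 -Regular) G → FourSlots G
fourSlots G regular = record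
  { slot        = slot
  ; rank        = λ h → Fin.cast (regular (vertex h)) (index (h∈ h))
  ; slot-rank   = λ h → trans (cong (lookup (endsAt (vertex h)))
      (Fin.cast-involutive (sym (regular (vertex h))) (regular (vertex h)) _))
          (sym (lookup-index (h∈ h)))
  ; vertex-slot = vertex-slot
  ; rank-slot   = λ v i → rank-unique v (slot v i) i (vertex-slot v i) refl
  }
  where
  open Graph G
  h∈ : ∀ h → h ∈ endsAt (vertex h)
  h∈ h = ∈-filter⁺ (λ h′ → vertex h′ Fin.≟ vertex h) (∈-allFin h) refl
  slot : Vertex → Fin 4 → End
  slot v i = lookup (endsAt v) (Fin.cast (sym (regular v)) i)
  vertex-slot : ∀ v i → vertex (slot v i) ≡ v
  vertex-slot v i = proj₂ (∈-filter⁻ (λ h → vertex h Fin.≟ v) {xs = allFin (#E * 2)}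
      (∈-lookup {xs = endsAt v} (Fin.cast (sym (regular v)) i)))
  rank-unique : ∀ v h i → vertex h ≡ v → h ≡ slot v i →
      Fin.cast (regular (vertex h)) (index (h∈ h)) ≡ i
  rank-unique v h i refl eq = trans
    (cong (Fin.cast (regular v))
      (lookup-injective (Unique.filter⁺ (λ h → vertex h Fin.≟ v) (Unique.allFin⁺ _))
        (trans (sym (lookup-index (h∈ h))) eq)))
    (Fin.cast-involutive (regular v) (sym (regular v)) i)

-- A-trails as choices of noncrossing matchings

module ATrails {G} (slots : FourSlots G) where
  open Graph G
  open FourSlots slots

  slotsAt : Vertex → List End
  slotsAt v = map (slot v) (allFin 4)

  rotationMap : RotationMap
  rotationMap = record
    { graph      = G
    ; ordering   = slotsAt
    ; ordering-↭ = λ v → ∼bag⇒↭ (unique∧set⇒bag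
        (Unique.map⁺ (slot-injective v) (Unique.allFin⁺ 4))
        (Unique.filter⁺ (λ h → vertex h Fin.≟ v) (Unique.allFin⁺ _))
        (mk⇔ (to v) (from v)))
    }
    where
    to : ∀ v {h} → h ∈ slotsAt v → h ∈ endsAt v
    to v h∈ with i , _ , refl ← ∈-map⁻ (slot v) h∈ =
      ∈-filter⁺ (λ h → vertex h Fin.≟ v) (∈-allFin _) (vertex-slot v i)
    from : ∀ v {h} → h ∈ endsAt v → h ∈ slotsAt v
    from v {h} h∈ with refl ← proj₂ (∈-filter⁻ (λ h → vertex h Fin.≟ v) {xs = allFin (#E * 2)} h∈) =
      subst (_∈ slotsAt v) (slot-rank h) (∈-map⁺ (slot v) (∈-allFin (rank h)))

  regular : (4 -Regular) G
  regular v = sym (↭-length (RotationMap.ordering-↭ rotationMap v))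

  -- The pairing 2 is the one that matches opposite positions.
  noncrossing⇒adjacent : ∀ v i k → k ≢ 2F →
      CyclicallyAdjacent (slotsAt v) (slot v i) (slot v (pairing4 k i))
  noncrossing⇒adjacent v i  2F k≢2 = contradiction refl k≢2
  noncrossing⇒adjacent v 0F 0F _ = inj₁ (here refl)
  noncrossing⇒adjacent v 1F 0F _ = inj₂ (here refl)
  noncrossing⇒adjacent v 2F 0F _ = inj₁ (there (there (here refl)))
  noncrossing⇒adjacent v 3F 0F _ = inj₂ (there (there (here refl)))
  noncrossing⇒adjacent v 0F 1F _ = inj₂ (there (there (there (here refl))))
  noncrossing⇒adjacent v 1F 1F _ = inj₁ (there (here refl))
  noncrossing⇒adjacent v 2F 1F _ = inj₂ (there (here refl))
  noncrossing⇒adjacent v 3F 1F _ = inj₁ (there (there (there (here refl))))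

  -- The neighbours of position 0 in the cyclic order are 1 and 3, and the slots are distinct.
  -- Refuting this one pair excludes matching 2 altogether, as it always joins the positions 0 and
  -- 2.
  opposite-nonadjacent : ∀ v → ¬ CyclicallyAdjacent (slotsAt v) (slot v 0F) (slot v 2F)
  opposite-nonadjacent v = λ where
      (inj₁ (here eq))                         → clash (,-injectiveʳ eq) λ ()
      (inj₁ (there (here eq)))                 → clash (,-injectiveˡ eq) λ ()
      (inj₁ (there (there (here eq))))         → clash (,-injectiveˡ eq) λ ()
      (inj₁ (there (there (there (here eq))))) → clash (,-injectiveˡ eq) λ ()
      (inj₂ (here eq))                         → clash (,-injectiveˡ eq) λ ()
      (inj₂ (there (here eq)))                 → clash (,-injectiveˡ eq) λ ()
      (inj₂ (there (there (here eq))))         → clash (,-injectiveʳ eq) λ ()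
      (inj₂ (there (there (there (here eq))))) → clash (,-injectiveˡ eq) λ ()
    where
    clash : ∀ {A : Set} {i j} → slot v i ≡ slot v j → i ≢ j → A
    clash eq i≢j = contradiction (slot-injective v eq) i≢j

  open RotationMap rotationMap using (IsATrail)

  nonadjacent : ∀ v {w h} → w ≡ v → h ≡ slot v 2F → ¬ CyclicallyAdjacent (slotsAt w) (slot v 0F) h
  nonadjacent v refl refl = opposite-nonadjacent v

  adjacent⇒noncrossing : ∀ {τ s} → τ ≗ pairingOf s →
    (∀ h → CyclicallyAdjacent (slotsAt (vertex h)) h (τ h)) → ∀ v → s v ≢ 2F
  adjacent⇒noncrossing {s = s} eq adjacent v s≡2 = nonadjacent v (vertex-slot v 0F)
    (trans (eq (slot v 0F)) (trans (pairingOf-slot s v 0F)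
        (cong (λ k → slot v (pairing4 k 0F)) s≡2)))
    (adjacent (slot v 0F))

  aTrail⇒choice : ∀ {τ} → IsATrail τ →
    ∃[ s ] (τ ≗ pairingOf s) × (∀ v → s v ≢ 2F) × Connected (pairingOf s)
  aTrail⇒choice (tour , adjacent) =
    let s , eq , connected = tour⇒choice tour in
    s , eq , adjacent⇒noncrossing {s = s} eq adjacent , connected

  choice⇒aTrail : ∀ {τ s} → pairingOf s ≗ τ → (∀ v → s v ≢ 2F) → Connected (pairingOf s) →
      IsATrail τ
  choice⇒aTrail {s = s} eq noncrossing connected =
    choice⇒tour {s = s} eq connected , λ h →
      subst₂ (CyclicallyAdjacent (slotsAt (vertex h))) (slot-rank h) (eq h)
        (noncrossing⇒adjacent (vertex h) (rank h) (s (vertex h)) (noncrossing (vertex h)))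

-- The gadget

-- inj₁ 0, 1, 2, 3 are the ends a, c, e, f; inj₂ 0, …, 7 are the ends of m, n, b, d
-- in this order, so that inj₂ (2 q + r) is the end r of the edge q.
Local : Set
Local = Fin 4 ⊎ Fin 8

block : Local → Fin 3
block (inj₁ 0F) = 0F
block (inj₁ 1F) = 1F
block (inj₁ 2F) = 2F
block (inj₁ 3F) = 2F
block (inj₂ 0F) = 0F
block (inj₂ 1F) = 1F
block (inj₂ 2F) = 0F
block (inj₂ 3F) = 1F
block (inj₂ 4F) = 0F
block (inj₂ 5F) = 2F
block (inj₂ 6F) = 1F
block (inj₂ 7F) = 2F

position : Local → Fin 4
position (inj₁ 0F) = 0F
position (inj₁ 1F) = 0F
position (inj₁ 2F) = 1F
position (inj₁ 3F) = 3F
position (inj₂ 0F) = 3F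
position (inj₂ 1F) = 3F
position (inj₂ 2F) = 2F
position (inj₂ 3F) = 2F
position (inj₂ 4F) = 1F
position (inj₂ 5F) = 0F
position (inj₂ 6F) = 1F
position (inj₂ 7F) = 2F

-- The rows are the cyclic orders of x, y and z.
at : Fin 3 → Fin 4 → Local
at 0F 0F = inj₁ 0F
at 0F 1F = inj₂ 4F
at 0F 2F = inj₂ 2F
at 0F 3F = inj₂ 0F
at 1F 0F = inj₁ 1F
at 1F 1F = inj₂ 6F
at 1F 2F = inj₂ 3F
at 1F 3F = inj₂ 1F
at 2F 0F = inj₂ 5F
at 2F 1F = inj₁ 2F
at 2F 2F = inj₂ 7F
at 2F 3F = inj₁ 3F

allLocal? : ∀ {P : Local → Set} → (∀ l → Dec (P l)) → Dec (∀ l → P l)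
allLocal? P? with Fin.all? (P? ∘ inj₁) | Fin.all? (P? ∘ inj₂)
... | yes p | yes q = yes λ { (inj₁ i) → p i ; (inj₂ j) → q j }
... | no ¬p | _     = no λ p → ¬p (p ∘ inj₁)
... | yes _ | no ¬q = no λ p → ¬q (p ∘ inj₂)

_≟L_ : (l l′ : Local) → Dec (l ≡ l′)
_≟L_ = Sum.≡-dec Fin._≟_ Fin._≟_

block-at : ∀ k p → block (at k p) ≡ k
block-at = from-yes (Fin.all? λ k → Fin.all? λ p → block (at k p) Fin.≟ k)

position-at : ∀ k p → position (at k p) ≡ p
position-at = from-yes (Fin.all? λ k → Fin.all? λ p → position (at k p) Fin.≟ p)

at-block-position : ∀ l → at (block l) (position l) ≡ l
at-block-position = from-yes (allLocal? λ l → at (block l) (position l) ≟L l)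

flip : Fin 8 → Fin 8
flip j = combine (quotient {4} 2 j) (opposite (remainder {4} 2 j))

turn : (Fin 3 → Fin 3) → Local → Local
turn T l = at (block l) (pairing4 (T (block l)) (position l))

turn-cong : ∀ {T T′} → T ≗ T′ → turn T ≗ turn T′
turn-cong eq l = cong (λ k → at (block l) (pairing4 k (position l))) (eq (block l))

-- A state without closed circle is numbered by the matching of a, c, e, f that it realizes,
-- together with a bit that distinguishes the two states realizing it. The bit leaves no trace in
-- `G` and accounts for the factor 2 per vertex.
pairingType : Fin 6 → Fin 3
pairingType = quotient {3} 2

spareBit : Fin 6 → Fin 2
spareBit = remainder {3} 2

bit : Fin 2 → Fin 3
bit = Fin.inject₁

-- Pairing 0 of x or y matches m with n.  If neither does so, the gadget realizes
-- ac|ef; if exactly one does, z decides between af|ce and ae|cf.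
states : Fin 3 → Fin 2 → Fin 3 → Fin 3
states 0F b 0F = 1F
states 0F b 1F = 1F
states 0F b 2F = bit b
states 1F b 0F = bit b
states 1F b 1F = bit (opposite b)
states 1F b 2F = 1F
states 2F b 0F = bit b
states 2F b 1F = bit (opposite b)
states 2F b 2F = 0F

gadgetState : Fin 6 → Fin 3 → Fin 3
gadgetState u = states (pairingType u) (spareBit u)

gadgetState-noncrossing : ∀ u k → gadgetState u k ≢ 2F
gadgetState-noncrossing = from-yes (Fin.all? λ u → Fin.all? λ k → ¬? (gadgetState u k Fin.≟ 2F))

gadgetState-injective : ∀ u u′ → gadgetState u ≗ gadgetState u′ → u ≡ u′
gadgetState-injective = from-yes (Fin.all? λ u → Fin.all? λ u′ →
  (Fin.all? λ k → gadgetState u k Fin.≟ gadgetState u′ k) →-dec (u Fin.≟ u′))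

gadgetState-complete : ∀ {T} → (∀ k → T k ≢ 2F) → ¬ (T 0F ≡ 0F × T 1F ≡ 0F) →
    ∃[ u ] T ≗ gadgetState u
gadgetState-complete {T} noncrossing open′ = go (T 0F) refl (T 1F) refl (T 2F) refl
  where
  go : ∀ x → T 0F ≡ x → ∀ y → T 1F ≡ y → ∀ z → T 2F ≡ z → ∃[ u ] T ≗ gadgetState u
  go 2F p y  q z  r = contradiction p (noncrossing 0F)
  go x  p 2F q z  r = contradiction q (noncrossing 1F)
  go x  p y  q 2F r = contradiction r (noncrossing 2F)
  go 0F p 0F q z  r = contradiction (p , q) open′
  go 1F p 1F q 0F r = 0F , λ { 0F → p ; 1F → q ; 2F → r }
  go 1F p 1F q 1F r = 1F , λ { 0F → p ; 1F → q ; 2F → r }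
  go 0F p 1F q 1F r = 2F , λ { 0F → p ; 1F → q ; 2F → r }
  go 1F p 0F q 1F r = 3F , λ { 0F → p ; 1F → q ; 2F → r }
  go 0F p 1F q 0F r = 4F , λ { 0F → p ; 1F → q ; 2F → r }
  go 1F p 0F q 0F r = 5F , λ { 0F → p ; 1F → q ; 2F → r }

-- The first argument is fuel; no strand passes through more than four vertices.
exit : ℕ → Fin 6 → Local → Fin 4
exit zero    u l = 0F
exit (suc n) u l with turn (gadgetState u) l
... | inj₁ i = i
... | inj₂ j = exit n u (inj₂ (flip j))

exitOf : Fin 6 → Local → Fin 4
exitOf = exit 4

-- Passing to `turn` reverses the direction in which the strand through `l` is followed, so the exit
-- becomes the other outer end of the same strand, which is its partner in the realized matching.
-- `exit-flip` holds for the same reason. The finitely many cases are checked by computation.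
exit-turn : ∀ u l → exitOf u (turn (gadgetState u) l) ≡ pairing4 (pairingType u) (exitOf u l)
exit-turn = from-yes (Fin.all? λ u → allLocal? λ l →
  exitOf u (turn (gadgetState u) l) Fin.≟ pairing4 (pairingType u) (exitOf u l))

exit-flip : ∀ u j → exitOf u (inj₂ (flip j)) ≡ pairing4 (pairingType u) (exitOf u (inj₂ j))
exit-flip = from-yes (Fin.all? λ u → Fin.all? λ j →
  exitOf u (inj₂ (flip j)) Fin.≟ pairing4 (pairingType u) (exitOf u (inj₂ j)))

exit-external : ∀ u i → exitOf u (inj₁ i) ≡ pairing4 (pairingType u) i
exit-external = from-yes (Fin.all? λ u → Fin.all? λ i →
  exitOf u (inj₁ i) Fin.≟ pairing4 (pairingType u) i)

flipInner : Local → Local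
flipInner (inj₁ i) = inj₁ i
flipInner (inj₂ j) = inj₂ (flip j)

-- `exit` yields only the last end of a strand; here the end reached after each vertex is kept, from
-- which an actual path can be built.
walk : Fin 6 → Local → ℕ → Local
walk u l zero    = turn (gadgetState u) l
walk u l (suc n) = turn (gadgetState u) (flipInner (walk u l n))

walk-exit : ∀ u l → ∃[ n ] walk u l (toℕ n) ≡ inj₁ (exitOf u l)
walk-exit = from-yes (Fin.all? λ u → allLocal? λ l → Fin.any? {4} λ n →
  walk u l (toℕ n) ≟L inj₁ (exitOf u l))

-- Insertion of the gadgets into a graph

module Gadgets {G} (slots : FourSlots G) where
  open Graph G
  open FourSlots slots

  #E′ #V′ : ℕ
  #E′ = #E + #V * 4
  #V′ = #V * 3

  End′ : Set
  End′ = Fin (#E′ * 2)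

  -- The old edges come first among the new ones, so an old end keeps its number and only its type
  -- changes.
  external : End → End′
  external h = combine (edge h ↑ˡ #V * 4) (remainder {#E} 2 h)

  internal : Vertex → Fin 8 → End′
  internal v j = combine (#E ↑ʳ combine v (quotient {4} 2 j)) (remainder {4} 2 j)

  global : Vertex → Local → End′
  global v (inj₁ i) = external (slot v i)
  global v (inj₂ j) = internal v j

  localOf : End → Vertex × Local
  localOf h = vertex h , inj₁ (rank h)

  local′ : Fin #E ⊎ Fin (#V * 4) → Fin 2 → Vertex × Local
  local′ (inj₁ e) r = localOf (combine e r)
  local′ (inj₂ k) r = quotient 4 k , inj₂ (combine (remainder {#V} 4 k) r)

  local : End′ → Vertex × Local
  local h = local′ (splitAt #E (quotient {#E′} 2 h)) (remainder {#E′} 2 h)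

  local-combine : ∀ (e : Fin #E′) (r : Fin 2) → local (combine e r) ≡ local′ (splitAt #E e) r
  local-combine e r = cong₂ (λ e r → local′ (splitAt #E e) r)
    (cong proj₁ (Fin.remQuot-combine e r)) (cong proj₂ (Fin.remQuot-combine e r))

  local-external : ∀ h → local (external h) ≡ localOf h
  local-external h = trans (local-combine _ _)
    (trans (cong (λ s → local′ s (remainder {#E} 2 h)) (Fin.splitAt-↑ˡ #E (edge h) (#V * 4)))
      (cong localOf (end-combine h)))

  local-global : ∀ v l → local (global v l) ≡ (v , l)
  local-global v (inj₁ i) = trans (local-external (slot v i))
    (cong₂ (λ v i → v , inj₁ i) (vertex-slot v i) (rank-slot v i))
  local-global v (inj₂ j) = trans (local-combine _ _)
    (trans (cong (λ s → local′ s (remainder {4} 2 j))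
        (Fin.splitAt-↑ʳ #E (#V * 4) (combine v (quotient {4} 2 j))))
      (cong₂ _,_ (cong proj₁ (Fin.remQuot-combine v (quotient {4} 2 j)))
        (cong inj₂ (trans (cong (λ q → combine q (remainder {4} 2 j))
            (cong proj₂ (Fin.remQuot-combine v (quotient {4} 2 j))))
          (Fin.combine-remQuot {4} 2 j)))))

  globalOf : Vertex × Local → End′
  globalOf (v , l) = global v l

  globalOf-localOf : ∀ h → globalOf (localOf h) ≡ external h
  globalOf-localOf h = cong external (slot-rank h)

  global-local′ : ∀ s (r : Fin 2) → globalOf (local′ s r) ≡ combine (Fin.join #E (#V * 4) s) r
  global-local′ (inj₁ e) r = trans (globalOf-localOf (combine e r))
    (cong₂ (λ e r → combine (e ↑ˡ #V * 4) r)
      (cong proj₁ (Fin.remQuot-combine e r)) (cong proj₂ (Fin.remQuot-combine e r)))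
  global-local′ (inj₂ k) r = cong₂ (λ k r → combine (#E ↑ʳ k) r)
    (trans (cong (combine (quotient {#V} 4 k))
        (cong proj₁ (Fin.remQuot-combine (remainder {#V} 4 k) r)))
      (Fin.combine-remQuot {#V} 4 k))
    (cong proj₂ (Fin.remQuot-combine (remainder {#V} 4 k) r))

  global-local : ∀ h → globalOf (local h) ≡ h
  global-local h = trans (global-local′ (splitAt #E (quotient {#E′} 2 h)) (remainder {#E′} 2 h))
    (trans (cong (λ e → combine e (remainder {#E′} 2 h))
        (Fin.join-splitAt #E (#V * 4) (quotient {#E′} 2 h)))
      (Fin.combine-remQuot {#E′} 2 h))

  vertexOf : Vertex × Local → Fin #V′
  vertexOf (v , l) = combine v (block l)

  graph′ : Graph
  graph′ = record { #V = #V′ ; #E = #E′ ; vertex = λ h → vertexOf (local h) }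

  slot′ : Fin #V′ → Fin 4 → End′
  slot′ x p = global (quotient 3 x) (at (remainder {#V} 3 x) p)

  slot′-combine : ∀ (v : Vertex) (k : Fin 3) p → slot′ (combine v k) p ≡ global v (at k p)
  slot′-combine v k p = cong₂ (λ v k → global v (at k p))
    (cong proj₁ (Fin.remQuot-combine v k)) (cong proj₂ (Fin.remQuot-combine v k))

  slot′-vertexOf : ∀ v l → slot′ (vertexOf (v , l)) (position l) ≡ global v l
  slot′-vertexOf v l = trans (slot′-combine v (block l) (position l))
      (cong (global v) (at-block-position l))

  -- The slots of a new vertex are listed in the cyclic order prescribed by `at`, which makes
  -- matching 2 exactly the crossing that an A-trail avoids.
  slots′ : FourSlots graph′
  slots′ = record
    { slot        = slot′
    ; rank        = λ h → position (proj₂ (local h))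
    ; slot-rank   = λ h → trans (slot′-vertexOf (proj₁ (local h)) (proj₂ (local h)))
        (global-local h)
    ; vertex-slot = λ x p → trans (cong vertexOf
        (local-global (quotient 3 x) (at (remainder {#V} 3 x) p)))
        (trans (cong (combine (quotient {#V} 3 x)) (block-at (remainder {#V} 3 x) p))
            (Fin.combine-remQuot {#V} 3 x))
    ; rank-slot   = λ x p → trans (cong (position ∘ proj₂)
        (local-global (quotient 3 x) (at (remainder {#V} 3 x) p)))
        (position-at (remainder {#V} 3 x) p)
    }

  module G′ = Graph graph′
  module S′ = FourSlots slots′

  otherEnd′-external : ∀ h → G′.otherEnd (external h) ≡ external (otherEnd h)
  otherEnd′-external h = trans (S′.otherEnd-combine (edge h ↑ˡ #V * 4) (remainder {#E} 2 h))
    (sym (cong₂ (λ e r → combine (e ↑ˡ #V * 4) r)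
      (cong proj₁ (Fin.remQuot-combine (edge h) (opposite (remainder {#E} 2 h))))
      (cong proj₂ (Fin.remQuot-combine (edge h) (opposite (remainder {#E} 2 h))))))

  otherEnd′-internal : ∀ v j → G′.otherEnd (internal v j) ≡ internal v (flip j)
  otherEnd′-internal v j = trans (S′.otherEnd-combine _ _)
    (sym (cong₂ (λ q r → combine (#E ↑ʳ combine v q) r)
      (cong proj₁ (Fin.remQuot-combine (quotient {4} 2 j) (opposite (remainder {4} 2 j))))
      (cong proj₂ (Fin.remQuot-combine (quotient {4} 2 j) (opposite (remainder {4} 2 j))))))

  statesAt : (Fin #V′ → Fin 3) → Vertex → Fin 3 → Fin 3
  statesAt s v k = s (combine v k)

  pairing′-global : ∀ s v l → S′.pairingOf s (global v l) ≡ global v (turn (statesAt s v) l)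
  pairing′-global s v l =
    trans (cong (S′.pairingOf s) (sym (slot′-vertexOf v l)))
      (trans (S′.pairingOf-slot s (vertexOf (v , l)) (position l))
        (slot′-combine v (block l) (pairing4 (statesAt s v (block l)) (position l))))

  -- If x and y both pair m with n, the ends inj₂ 0, …, inj₂ 3 of m and n form a
  -- closed circle.
  doubleEdge-turn : ∀ {T} → T 0F ≡ 0F → T 1F ≡ 0F → ∀ (k : Fin 4) →
    Σ (Fin 4) λ k′ → turn T (inj₂ (k ↑ˡ 4)) ≡ inj₂ (k′ ↑ˡ 4)
  doubleEdge-turn p q 0F rewrite p = 2F , refl
  doubleEdge-turn p q 1F rewrite q = 3F , refl
  doubleEdge-turn p q 2F rewrite p = 0F , refl
  doubleEdge-turn p q 3F rewrite q = 1F , refl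

  doubleEdge-flip : ∀ (k : Fin 4) → Σ (Fin 4) λ k′ → flip (k ↑ˡ 4) ≡ k′ ↑ˡ 4
  doubleEdge-flip 0F = 1F , refl
  doubleEdge-flip 1F = 0F , refl
  doubleEdge-flip 2F = 3F , refl
  doubleEdge-flip 3F = 2F , refl

  -- If x and y both pair m with n, either kind of step leads from an end of m or n to an end of m
  -- or n, so no path from there reaches a.
  connected⇒open : ∀ {s} → S′.Connected (S′.pairingOf s) → ∀ v →
    ¬ (statesAt s v 0F ≡ 0F × statesAt s v 1F ≡ 0F)
  connected⇒open {s} connected v (p , q)
    with stay (connected (internal v 0F) (global v (inj₁ 0F))) (0F , refl)
    where
    OnDoubleEdge : End′ → Set
    OnDoubleEdge h = Σ (Fin 4) λ k → h ≡ internal v (k ↑ˡ 4)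
    stay : ∀ {x y} → Star (S′.Step (S′.pairingOf s)) x y → OnDoubleEdge x → OnDoubleEdge y
    stay ε on = on
    stay (inj₁ refl ◅ path) (k , refl) = let k′ , eq = doubleEdge-flip k in
      stay path (k′ , trans (otherEnd′-internal v (k ↑ˡ 4)) (cong (internal v) eq))
    stay (inj₂ refl ◅ path) (k , refl) = let k′ , eq = doubleEdge-turn {statesAt s v} p q k in
      stay path (k′ , trans (pairing′-global s v (inj₂ (k ↑ˡ 4))) (cong (global v) eq))
  ... | k , eq with () ← ,-injectiveʳ (trans (sym (local-global v (inj₁ 0F)))
                     (trans (cong local eq) (local-global v (inj₂ (k ↑ˡ 4)))))

  module _ (s : Fin #V′ → Fin 3) (u : Vertex → Fin 6)
           (s≗ : ∀ v → statesAt s v ≗ gadgetState (u v)) where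
    private
      τ : End → End
      τ = pairingOf (pairingType ∘ u)
      τ′ : End′ → End′
      τ′ = S′.pairingOf s

    τ-slot : ∀ v i → τ (slot v i) ≡ slot v (pairing4 (pairingType (u v)) i)
    τ-slot = pairingOf-slot (pairingType ∘ u)

    τ′-global : ∀ v l → τ′ (global v l) ≡ global v (turn (gadgetState (u v)) l)
    τ′-global v l = trans (pairing′-global s v l) (cong (global v) (turn-cong (s≗ v) l))

    -- The contraction of the gadgets, along which paths are mapped to `G`. An outer end goes to its
    -- partner under `τ`, not to itself, because following a strand starts with a turn.
    exitEnd : Vertex × Local → End
    exitEnd (v , l) = slot v (exitOf (u v) l)

    exitEnd-τ′ : ∀ v l → exitEnd (local (τ′ (global v l))) ≡ τ (exitEnd (v , l))
    exitEnd-τ′ v l = trans (cong exitEnd (trans (cong local (τ′-global v l))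
        (local-global v (turn (gadgetState (u v)) l))))
      (trans (cong (slot v) (exit-turn (u v) l)) (sym (τ-slot v (exitOf (u v) l))))

    exitEnd-localOf : ∀ h → exitEnd (localOf h) ≡ τ h
    exitEnd-localOf h = cong (slot (vertex h)) (exit-external (u (vertex h)) (rank h))

    exitEnd-internal : ∀ v j → exitEnd (local (G′.otherEnd (internal v j))) ≡
        τ (exitEnd (v , inj₂ j))
    exitEnd-internal v j =
      trans (cong exitEnd (trans (cong local (otherEnd′-internal v j))
          (local-global v (inj₂ (flip j)))))
        (trans (cong (slot v) (exit-flip (u v) j)) (sym (τ-slot v (exitOf (u v) (inj₂ j)))))

    τ-involutive : ∀ h → τ (τ h) ≡ h
    τ-involutive = pairing-involutive (pairingOf-isPairing (pairingType ∘ u))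

    exit-step : ∀ v l {y} → S′.Step τ′ (global v l) y →
        Star (Step τ) (exitEnd (v , l)) (exitEnd (local y))
    exit-step v l (inj₂ refl) = return (inj₂ (exitEnd-τ′ v l))
    exit-step v (inj₂ j) (inj₁ refl) = return (inj₂ (exitEnd-internal v j))
    exit-step v (inj₁ i) (inj₁ refl) =
      -- The outer ends of an old edge are mapped to their partners, so the image path first returns
      -- by `τ`, then crosses the edge and applies `τ` on arrival.
      inj₂ (sym (trans (cong τ exit≡) (τ-involutive _))) ◅ inj₁ refl ◅ inj₂ arrival ◅ ε
      where
      exit≡ : exitEnd (v , inj₁ i) ≡ τ (slot v i)
      exit≡ = trans (cong (slot v) (exit-external (u v) i)) (sym (τ-slot v i))
      arrival : exitEnd (local (G′.otherEnd (external (slot v i)))) ≡ τ (otherEnd (slot v i))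
      arrival = trans (cong exitEnd (trans (cong local (otherEnd′-external (slot v i)))
          (local-external _)))
        (exitEnd-localOf _)

    exit-path : ∀ {x y} → Star (S′.Step τ′) x y →
        Star (Step τ) (exitEnd (local x)) (exitEnd (local y))
    exit-path ε = ε
    exit-path {x} (_◅_ {j = y} step path) = exit-step (proj₁ (local x)) (proj₂ (local x))
      (subst (λ x → S′.Step τ′ x y) (sym (global-local x)) step) ◅◅ exit-path path

    contract-connected : S′.Connected τ′ → Connected τ
    contract-connected connected x y = subst₂ (Star (Step τ)) (leave x) (leave y)
      -- The path starts at the partner of `x`, since this is the outer end that the contraction
      -- sends to `x`; likewise for `y`.
      (exit-path (connected (external (τ x)) (external (τ y))))
      where
      leave : ∀ x → exitEnd (local (external (τ x))) ≡ x
      leave x = trans (cong exitEnd (local-external (τ x)))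
        (trans (exitEnd-localOf (τ x)) (τ-involutive x))

    walk-path : ∀ v l n → Star (S′.Step τ′) (global v l) (global v (walk (u v) l n))
    walk-path v l zero    = return (inj₂ (sym (τ′-global v l)))
    walk-path v l (suc n) = walk-path v l n ◅◅ (flip-path (walk (u v) l n)
      ◅◅ return (inj₂ (sym (τ′-global v (flipInner (walk (u v) l n))))))
      where
      flip-path : ∀ l → Star (S′.Step τ′) (global v l) (global v (flipInner l))
      flip-path (inj₁ i) = ε
      flip-path (inj₂ j) = return (inj₁ (sym (otherEnd′-internal v j)))

    to-exit : ∀ v l → Star (S′.Step τ′) (global v l) (external (exitEnd (v , l)))
    to-exit v l with n , eq ← walk-exit (u v) l =
      subst (λ l′ → Star (S′.Step τ′) (global v l) (global v l′)) eq (walk-path v l (toℕ n))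

    expand-path : ∀ {x y} → Star (Step τ) x y → Star (S′.Step τ′) (external x) (external y)
    expand-path ε = ε
    expand-path (inj₁ refl ◅ path) = inj₁ (sym (otherEnd′-external _)) ◅ expand-path path
    expand-path {x} (inj₂ refl ◅ path) =
      subst₂ (Star (S′.Step τ′)) (globalOf-localOf x) (cong external (exitEnd-localOf x))
        (to-exit (vertex x) (inj₁ (rank x)))
      ◅◅ expand-path path

    step-sym : ∀ {x y} → S′.Step τ′ x y → S′.Step τ′ y x
    step-sym (inj₁ refl) = inj₁ (sym (S′.otherEnd-involutive _))
    step-sym (inj₂ refl) = inj₂ (sym (S′.pairing-involutive (S′.pairingOf-isPairing s) _))

    -- Every end is joined by its strand to an outer end, and outer ends are joined by lifting paths
    -- of `G`, whose `τ`-steps become whole strands. Steps are symmetric, so the strand at `y` can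
    -- be followed backwards.
    expand-connected : Connected τ → S′.Connected τ′
    expand-connected connected x y = from-global x
      ◅◅ expand-path (connected (exitEnd (local x)) (exitEnd (local y)))
      ◅◅ reverse step-sym (from-global y)
      where
      from-global : ∀ x → Star (S′.Step τ′) x (external (exitEnd (local x)))
      from-global x = subst (λ x′ → Star (S′.Step τ′) x′ (external (exitEnd (local x))))
        (global-local x) (to-exit (proj₁ (local x)) (proj₂ (local x)))

  open ATrails slots′ public using () renaming (rotationMap to map′; regular to regular′)

-- Counting

length-cartesianProduct : ∀ {A B : Set} (xs : List A) (ys : List B) →
  length (cartesianProduct xs ys) ≡ length xs * length ys
length-cartesianProduct []       ys = refl
length-cartesianProduct (x ∷ xs) ys = trans (List.length-++ (map (x ,_) ys))
  (cong₂ _+_ (List.length-map (x ,_) ys) (length-cartesianProduct xs ys))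

funToFin-cong : ∀ {m n} {f g : Fin m → Fin n} → f ≗ g → funToFin f ≡ funToFin g
funToFin-cong {zero}  eq = refl
funToFin-cong {suc m} eq = cong₂ combine (eq 0F) (funToFin-cong (eq ∘ Fin.suc))

finToFun-injective : ∀ {m n} {c d : Fin (n ^ m)} → finToFun {n} {m} c ≗ finToFun d → c ≡ d
finToFun-injective {m} {n} {c} {d} eq = trans (sym (Fin.funToFin-finToFin {m} {n} c))
  (trans (funToFin-cong eq) (Fin.funToFin-finToFin {m} {n} d))

module Counting {G} (slots : FourSlots G) where
  open Graph G
  open FourSlots slots
  open Gadgets slots

  stateOf : (Vertex → Fin 6) → Fin #V′ → Fin 3
  stateOf u x = gadgetState (u (quotient {#V} 3 x)) (remainder {#V} 3 x)

  stateOf-combine : ∀ u v → statesAt (stateOf u) v ≗ gadgetState (u v)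
  stateOf-combine u v k = cong₂ (λ v k → gadgetState (u v) k)
    (cong proj₁ (Fin.remQuot-combine v k)) (cong proj₂ (Fin.remQuot-combine v k))

  stateOf-unique : ∀ {s u} → (∀ v → statesAt s v ≗ gadgetState (u v)) → s ≗ stateOf u
  stateOf-unique {s} eq x = trans (cong s (sym (Fin.combine-remQuot {#V} 3 x)))
    (eq (quotient {#V} 3 x) (remainder {#V} 3 x))

  pairing′-cong : ∀ {s s′} → s ≗ s′ → S′.pairingOf s ≗ S′.pairingOf s′
  pairing′-cong eq h = cong (λ k → slot′ (G′.vertex h) (pairing4 k (FourSlots.rank slots′ h)))
      (eq (G′.vertex h))

  Code Code′ Bits : Set
  Code  = Fin ((#E * 2) ^ (#E * 2))
  Code′ = Fin ((#E′ * 2) ^ (#E′ * 2))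
  Bits  = Fin (2 ^ #V)

  -- The witness `u` chooses a state at every vertex. Each side determines `u` and is determined by
  -- it, so the relation is injective in both directions and serves for both inequalities.
  Corresponds : Code′ → Code × Bits → Set
  Corresponds c′ (c , b) = Σ (Vertex → Fin 6) λ u →
      (finToFun c′ ≗ S′.pairingOf (stateOf u))
    × (finToFun c ≗ pairingOf (pairingType ∘ u))
    × (finToFun b ≗ spareBit ∘ u)

  stateOf-injective : ∀ {u w} → S′.pairingOf (stateOf u) ≗ S′.pairingOf (stateOf w) → u ≗ w
  stateOf-injective {u} {w} eq v = gadgetState-injective (u v) (w v) λ k →
    trans (sym (stateOf-combine u v k))
      (trans (S′.pairingOf-injective {stateOf u} {stateOf w} eq (combine v k))
          (stateOf-combine w v k))

  typeBit-injective : ∀ {u w : Vertex → Fin 6} →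
    pairingOf (pairingType ∘ u) ≗ pairingOf (pairingType ∘ w) → spareBit ∘ u ≗ spareBit ∘ w → u ≗ w
  typeBit-injective {u} {w} type≗ bit≗ v =
    trans (sym (Fin.combine-remQuot {3} 2 (u v)))
      (trans (cong₂ combine (pairingOf-injective {pairingType ∘ u} {pairingType ∘ w} type≗ v)
          (bit≗ v))
        (Fin.combine-remQuot {3} 2 (w v)))

  corresponds-injectiveˡ : ∀ {c c′ y} → Corresponds c y → Corresponds c′ y → c ≡ c′
  corresponds-injectiveˡ {c} {c′} (u , eq , type , bit) (w , eq′ , type′ , bit′) =
    finToFun-injective {#E′ * 2} {#E′ * 2} {c} {c′} λ h →
      trans (eq h) (trans (pairing′-cong (λ x → cong (λ t → gadgetState t (remainder {#V} 3 x))
        (u≗w (quotient {#V} 3 x))) h) (sym (eq′ h)))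
    where
    u≗w : u ≗ w
    u≗w = typeBit-injective (λ h → trans (sym (type h)) (type′ h))
        (λ v → trans (sym (bit v)) (bit′ v))

  corresponds-injectiveʳ : ∀ {c y y′} → Corresponds c y → Corresponds c y′ → y ≡ y′
  corresponds-injectiveʳ {y = d , b} {y′ = d′ , b′} (u , eq , type , bit) (w , eq′ , type′ , bit′) =
    cong₂ _,_
      (finToFun-injective {#E * 2} {#E * 2} {d} {d′} λ h → trans (type h) (trans
        (cong (λ k → slot (vertex h) (pairing4 (pairingType k) (rank h))) (u≗w (vertex h)))
            (sym (type′ h))))
      (finToFun-injective {#V} {2} {b} {b′} λ v → trans (bit v) (trans (cong spareBit (u≗w v))
          (sym (bit′ v))))
    where
    u≗w : u ≗ w
    u≗w = stateOf-injective λ h → trans (sym (eq h)) (eq′ h)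

  module M′ = RotationMap map′

  atrails : List Code′
  atrails = filter (λ c → M′.isATrail? (finToFun c)) (allFin _)

  tours : List Code
  tours = filter (λ c → isEulerianTour? (finToFun c)) (allFin _)

  toursWithBits : List (Code × Bits)
  toursWithBits = cartesianProduct tours (allFin (2 ^ #V))

  atrail⇒tour : ∀ {c′} → M′.IsATrail (finToFun c′) →
    ∃[ y ] y ∈ toursWithBits × Corresponds c′ y
  atrail⇒tour {c′} trail =
    let s , eq , noncrossing , connected = ATrails.aTrail⇒choice slots′ trail
        complete = λ v → gadgetState-complete (λ k → noncrossing (combine v k))
            (connected⇒open {s} connected v)
        u = λ v → proj₁ (complete v)
        s≗ = λ v → proj₂ (complete v)
        c = funToFin (pairingOf (pairingType ∘ u))
        b = funToFin (spareBit ∘ u)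
        c≗ = Fin.finToFun-funToFin (pairingOf (pairingType ∘ u))
        tour = choice⇒tour {s = pairingType ∘ u} (λ h → sym (c≗ h))
            (contract-connected s u s≗ connected)
    in (c , b)
     , ∈-cartesianProduct⁺ (∈-filter⁺ (λ c → isEulerianTour? (finToFun c)) (∈-allFin c) tour)
         (∈-allFin b)
     , u , (λ h → trans (eq h) (pairing′-cong (stateOf-unique {s} {u} s≗) h)) , c≗ ,
         Fin.finToFun-funToFin (spareBit ∘ u)

  tour⇒atrail : ∀ {c b} → IsEulerianTour (finToFun c) →
    ∃[ c′ ] c′ ∈ atrails × Corresponds c′ (c , b)
  tour⇒atrail {c} {b} tour =
    let s , eq , connected = tour⇒choice tour
        -- The tour fixes the matching at each vertex; arbitrary bits complete it to a state.
        u = λ v → combine (s v) (finToFun b v)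
        type≗ : pairingType ∘ u ≗ s
        type≗ v = cong proj₁ (Fin.remQuot-combine (s v) (finToFun b v))
        τ≗ : pairingOf s ≗ pairingOf (pairingType ∘ u)
        τ≗ h = cong (λ k → slot (vertex h) (pairing4 k (rank h))) (sym (type≗ (vertex h)))
        connected-u = trail⇒connected (proj₂
            (tour-resp-≗ τ≗ (connected⇒tour (pairingOf-isPairing s) connected)))
        c′ = funToFin (S′.pairingOf (stateOf u))
        c′≗ = Fin.finToFun-funToFin (S′.pairingOf (stateOf u))
        trail = ATrails.choice⇒aTrail slots′ {s = stateOf u} (λ h → sym (c′≗ h))
          (λ x → gadgetState-noncrossing (u (quotient {#V} 3 x)) (remainder {#V} 3 x))
          (expand-connected (stateOf u) u (stateOf-combine u) connected-u)
    in c′ , ∈-filter⁺ (λ c → M′.isATrail? (finToFun c)) (∈-allFin c′) trail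
     , u , c′≗ , (λ h → trans (eq h) (τ≗ h))
     , (λ v → sym (cong proj₂ (Fin.remQuot-combine (s v) (finToFun b v))))

  #ATrails-map′ : #ATrails map′ ≡ #EulerianTours G * 2 ^ #V
  #ATrails-map′ = trans (ℕ.≤-antisym
      (related-length-≤ Corresponds (Unique.filter⁺ (λ c → M′.isATrail? (finToFun c))
          (Unique.allFin⁺ _))
        (λ c∈ → atrail⇒tour (proj₂ (∈-filter⁻ (λ c → M′.isATrail? (finToFun c)) {xs = allFin _}
            c∈)))
        corresponds-injectiveˡ)
      (related-length-≤ (λ y c′ → Corresponds c′ y)
        (Unique.cartesianProduct⁺ (Unique.filter⁺ (λ c → isEulerianTour? (finToFun c))
            (Unique.allFin⁺ _)) (Unique.allFin⁺ _))
        (λ y∈ → tour⇒atrail (proj₂ (∈-filter⁻ (λ c → isEulerianTour? (finToFun c)) {xs = allFin _}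
          (proj₁ (∈-cartesianProduct⁻ tours (allFin (2 ^ #V)) y∈)))))
        corresponds-injectiveʳ))
    (trans (length-cartesianProduct tours (allFin (2 ^ #V)))
      (cong (length tours *_) (List.length-tabulate id)))

-- Running times

n≤2^n : ∀ n → n ≤ 2 ^ n
n≤2^n zero    = z≤n
n≤2^n (suc n) = ℕ.≤-trans (s≤s (n≤2^n n))
  (ℕ.+-mono-≤ (ℕ.m^n>0 2 n) (ℕ.≤-reflexive (sym (ℕ.+-identityʳ (2 ^ n)))))

digits-≤ : ∀ {m n} → m ≤ 2 ^ n → ‖ m ‖ ≤ suc n
digits-≤ {m} {n} m≤2^n = s≤s (ℕ.≤-trans (⌊log₂⌋-mono-≤ m≤2^n) (ℕ.≤-reflexive (⌊log₂[2^n]⌋≡n n)))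

-- With suc n in place of n the bound is monotone in the power even at n = 0.
record PolyBounded (f : ℕ → ℕ) : Set where
  constructor polyBounded
  field
    factor power : ℕ
    bound        : ∀ n → f n ≤ factor * suc n ^ power

poly-const : ∀ c → PolyBounded (λ _ → c)
poly-const c = polyBounded c 0 λ n → ℕ.≤-reflexive (sym (ℕ.*-identityʳ c))

poly-id : PolyBounded (λ n → n)
poly-id = polyBounded 1 1 λ n →
  ℕ.≤-trans (ℕ.n≤1+n n) (ℕ.≤-reflexive (sym (trans (ℕ.*-identityˡ _) (ℕ.*-identityʳ (suc n)))))

poly-+ : ∀ {f g} → PolyBounded f → PolyBounded g → PolyBounded (λ n → f n + g n)
poly-+ (polyBounded c k p) (polyBounded d l q) = polyBounded (c + d) (k + l) λ n →
  ℕ.≤-trans (ℕ.+-mono-≤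
    (ℕ.≤-trans (p n) (ℕ.*-monoʳ-≤ c (ℕ.^-monoʳ-≤ (suc n) (ℕ.m≤m+n k l))))
    (ℕ.≤-trans (q n) (ℕ.*-monoʳ-≤ d (ℕ.^-monoʳ-≤ (suc n) (ℕ.m≤n+m l k)))))
  (ℕ.≤-reflexive (sym (ℕ.*-distribʳ-+ (suc n ^ (k + l)) c d)))

poly-* : ∀ {f g} → PolyBounded f → PolyBounded g → PolyBounded (λ n → f n * g n)
poly-* (polyBounded c k p) (polyBounded d l q) = polyBounded (c * d) (k + l) λ n →
  ℕ.≤-trans (ℕ.*-mono-≤ (p n) (q n)) (ℕ.≤-reflexive
    (trans (ℕ.[m*n]*[o*p]≡[m*o]*[n*p] c (suc n ^ k) d (suc n ^ l))
      (cong (c * d *_) (sym (ℕ.^-distribˡ-+-* (suc n) k l)))))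

^-distribʳ-* : ∀ k m n → (m * n) ^ k ≡ m ^ k * n ^ k
^-distribʳ-* zero    m n = refl
^-distribʳ-* (suc k) m n = trans (cong (m * n *_) (^-distribʳ-* k m n))
  (ℕ.[m*n]*[o*p]≡[m*o]*[n*p] m n (m ^ k) (n ^ k))

polynomiallyBounded : ∀ {f} → PolyBounded f → PolynomiallyBounded f
polynomiallyBounded {f} (polyBounded c k p) = c * 2 ^ k , k , bound
  where
  open ℕ.≤-Reasoning
  bound : ∀ n → f n ≤ c * 2 ^ k * n ^ k + c * 2 ^ k
  bound zero = begin
    f 0                              ≤⟨ p 0 ⟩
    c * 1 ^ k                        ≤⟨ ℕ.*-monoʳ-≤ c (ℕ.^-monoˡ-≤ k (s≤s z≤n)) ⟩
    c * 2 ^ k                        ≤⟨ ℕ.m≤n+m _ _ ⟩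
    c * 2 ^ k * 0 ^ k + c * 2 ^ k    ∎
  bound n@(suc m) = begin
    f n                              ≤⟨ p n ⟩
    c * suc n ^ k                    ≤⟨ ℕ.*-monoʳ-≤ c (ℕ.^-monoˡ-≤ k suc-n≤2n) ⟩
    c * (2 * n) ^ k                  ≡⟨ cong (c *_) (^-distribʳ-* k 2 n) ⟩
    c * (2 ^ k * n ^ k)              ≡⟨ ℕ.*-assoc c (2 ^ k) (n ^ k) ⟨
    c * 2 ^ k * n ^ k                ≤⟨ ℕ.m≤m+n _ _ ⟩
    c * 2 ^ k * n ^ k + c * 2 ^ k    ∎
    where
    suc-n≤2n : suc n ≤ 2 * n
    suc-n≤2n = ℕ.+-mono-≤ (s≤s (z≤n {m})) (ℕ.≤-reflexive (sym (ℕ.+-identityʳ n)))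

-- Bounds on values and costs

Fits : ℕ → Memory → Set
Fits L μ = ∀ a i → μ a i ≤ 2 ^ L

fits-write : ∀ {L μ} a i v → v ≤ 2 ^ L → Fits L μ → Fits L (write a i v μ)
fits-write a i v v≤ fits b j with (a ≡ᵇ b) ∧ (i ≡ᵇ j)
... | true  = v≤
... | false = fits b j

-- In a memory whose cells are at most 2 ^ `L`, the value of `e` is at most 2 ^ (`weight e` * `L`),
-- and its cost is at most `price e` * `L`. Both factors depend on the program text alone, so
-- evaluating an expression takes time linear in `L`.
weight : Expr → ℕ
weight (lit n)     = n
weight (get a e)   = 1
weight (op o e e′) = suc (weight e + weight e′)

price : Expr → ℕ
price (lit n)       = suc n
price (get a e)     = price e + 2
price (op o e e′)   = price e + price e′ + suc (weight (op o e e′))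

div-≤ : ∀ m n → ⟦ div ⟧ m n ≤ m
div-≤ m zero    = z≤n
div-≤ m (suc n) = ℕ.m/n≤m m (suc n)

mod-≤ : ∀ m n → ⟦ mod ⟧ m n ≤ m
mod-≤ m zero    = ℕ.≤-refl
mod-≤ m (suc n) = ℕ.m%n≤m m (suc n)

module _ (L : ℕ) (1≤L : 1 ≤ L) where
  open ℕ.≤-Reasoning

  lit-fits : ∀ n → n ≤ 2 ^ (n * L)
  lit-fits n = ℕ.≤-trans (n≤2^n n) (ℕ.^-monoʳ-≤ 2 (ℕ.≤-trans (ℕ.≤-reflexive (sym (ℕ.*-identityʳ n)))
      (ℕ.*-monoʳ-≤ n 1≤L)))

  -- Products add exponents. A sum needs one more binary digit, for which `suc` provides a whole
  -- further `L`. The other operations do not exceed their first argument.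
  op-fits : ∀ o {m n} a b → m ≤ 2 ^ (a * L) → n ≤ 2 ^ (b * L) → ⟦ o ⟧ m n ≤ 2 ^ (suc (a + b) * L)
  op-fits o {m} {n} a b m≤ n≤ = byOp o
    where
    split : 2 ^ (a * L) * 2 ^ (b * L) ≡ 2 ^ ((a + b) * L)
    split = trans (sym (ℕ.^-distribˡ-+-* 2 (a * L) (b * L)))
        (cong (2 ^_) (sym (ℕ.*-distribʳ-+ L a b)))
    step : 2 ^ ((a + b) * L) ≤ 2 ^ (suc (a + b) * L)
    step = ℕ.^-monoʳ-≤ 2 (ℕ.m≤n+m _ L)
    product : m * n ≤ 2 ^ (suc (a + b) * L)
    product = begin
      m * n                     ≤⟨ ℕ.*-mono-≤ m≤ n≤ ⟩
      2 ^ (a * L) * 2 ^ (b * L) ≡⟨ split ⟩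
      2 ^ ((a + b) * L)         ≤⟨ step ⟩
      2 ^ (suc (a + b) * L)     ∎
    left : ∀ {x} → x ≤ m → x ≤ 2 ^ (suc (a + b) * L)
    left {x} x≤m = begin
      x                         ≤⟨ x≤m ⟩
      m                         ≤⟨ m≤ ⟩
      2 ^ (a * L)               ≤⟨ ℕ.^-monoʳ-≤ 2 (ℕ.*-monoˡ-≤ L (ℕ.m≤m+n a b)) ⟩
      2 ^ ((a + b) * L)         ≤⟨ step ⟩
      2 ^ (suc (a + b) * L)     ∎
    byOp : ∀ o → ⟦ o ⟧ m n ≤ 2 ^ (suc (a + b) * L)
    byOp add = begin
      m + n                         ≤⟨ ℕ.+-mono-≤
        (ℕ.≤-trans m≤ (ℕ.^-monoʳ-≤ 2 (ℕ.*-monoˡ-≤ L (ℕ.m≤m+n a b))))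
        (ℕ.≤-trans n≤ (ℕ.^-monoʳ-≤ 2 (ℕ.*-monoˡ-≤ L (ℕ.m≤n+m b a)))) ⟩
      2 ^ ((a + b) * L) + 2 ^ ((a + b) * L) ≡⟨ cong (2 ^ ((a + b) * L) +_) (ℕ.+-identityʳ _) ⟨
      2 ^ suc ((a + b) * L)         ≤⟨ ℕ.^-monoʳ-≤ 2 (ℕ.+-monoˡ-≤ ((a + b) * L) 1≤L) ⟩
      2 ^ (suc (a + b) * L)         ∎
    byOp sub = left (ℕ.m∸n≤m m n)
    byOp mul = product
    byOp div = left (div-≤ m n)
    byOp mod = left (mod-≤ m n)

  module _ {μ} (fits : Fits L μ) where

    eval-fits : ∀ e → eval μ e ≤ 2 ^ (weight e * L)
    eval-fits (lit n)     = lit-fits n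
    eval-fits (get a e)   = ℕ.≤-trans (fits a (eval μ e))
        (ℕ.≤-reflexive (cong (2 ^_) (sym (ℕ.*-identityˡ L))))
    eval-fits (op o e e′) = op-fits o (weight e) (weight e′) (eval-fits e) (eval-fits e′)

    digits-weight : ∀ e → ‖ eval μ e ‖ ≤ suc (weight e) * L
    digits-weight e = ℕ.≤-trans (digits-≤ (eval-fits e)) (ℕ.+-monoˡ-≤ (weight e * L) 1≤L)

    cost-price : ∀ e → cost μ e ≤ price e * L
    cost-price (lit n) = digits-weight (lit n)
    cost-price (get a e) = begin
      cost μ e + ‖ μ a (eval μ e) ‖   ≤⟨ ℕ.+-mono-≤ (cost-price e) (digits-weight (get a e)) ⟩
      price e * L + 2 * L             ≡⟨ ℕ.*-distribʳ-+ L (price e) 2 ⟨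
      (price e + 2) * L               ∎
    cost-price (op o e e′) = begin
      cost μ e + cost μ e′ + ‖ eval μ (op o e e′) ‖
        ≤⟨ ℕ.+-mono-≤ (ℕ.+-mono-≤ (cost-price e) (cost-price e′)) (digits-weight (op o e e′)) ⟩
      price e * L + price e′ * L + suc (weight (op o e e′)) * L
        ≡⟨ cong (_+ suc (weight (op o e e′)) * L) (ℕ.*-distribʳ-+ L (price e) (price e′)) ⟨
      (price e + price e′) * L + suc (weight (op o e e′)) * L
        ≡⟨ ℕ.*-distribʳ-+ L (price e + price e′) (suc (weight (op o e e′))) ⟨
      price (op o e e′) * L ∎

digits-++ : ∀ xs ys → ‖ xs ++ ys ‖* ≡ ‖ xs ‖* + ‖ ys ‖*
digits-++ xs ys = trans (cong sum (List.map-++ ‖_‖ xs ys)) (sum-++ (map ‖_‖ xs) (map ‖_‖ ys))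

digits≤cost : ∀ μ e → ‖ eval μ e ‖ ≤ cost μ e
digits≤cost μ (lit n)     = ℕ.≤-refl
digits≤cost μ (get a e)   = ℕ.m≤n+m _ _
digits≤cost μ (op o e e′) = ℕ.m≤n+m _ (cost μ e + cost μ e′)

-- Each emitted number has been charged for its digits. The time spent on building a query therefore
-- bounds its length, which `ask` charges, without a separate estimate.
query≤time : ∀ {O p s s′ t} → O ⊢ p , s ⇓ s′ [ t ] →
  ‖ State.query s′ ‖* ≤ ‖ State.query s ‖* + t
query≤time ⇓skip = ℕ.m≤m+n _ _
query≤time {s = s} (⇓seq {t = t} {t′} p q) = ℕ.≤-trans (query≤time q)
  (ℕ.≤-trans (ℕ.+-monoˡ-≤ t′ (query≤time p)) (ℕ.≤-reflexive (ℕ.+-assoc ‖ State.query s ‖* t t′)))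
query≤time ⇓set = ℕ.m≤m+n _ _
query≤time {s = s} (⇓then {t = t} _ p) = ℕ.≤-trans (query≤time p) (ℕ.+-monoʳ-≤ ‖ State.query s ‖*
    (ℕ.m≤n+m t _))
query≤time {s = s} (⇓else {t = t} _ p) = ℕ.≤-trans (query≤time p) (ℕ.+-monoʳ-≤ ‖ State.query s ‖*
    (ℕ.m≤n+m t _))
query≤time (⇓stop _) = ℕ.m≤m+n _ _
query≤time {s = s} (⇓loop {e = e} {μ = μ} {t = t} {t′} _ p q) = ℕ.≤-trans (query≤time q)
  (ℕ.≤-trans (ℕ.+-monoˡ-≤ t′ (query≤time p)) (ℕ.≤-trans
    (ℕ.≤-reflexive (ℕ.+-assoc ‖ State.query s ‖* t t′))
    (ℕ.+-monoʳ-≤ ‖ State.query s ‖* (ℕ.+-monoˡ-≤ t′ (ℕ.m≤n+m t (cost μ e))))))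
query≤time (⇓emit {e} {μ} {q}) = ℕ.≤-trans (ℕ.≤-reflexive (digits-++ q [ eval μ e ]))
  (ℕ.+-monoʳ-≤ ‖ q ‖* (ℕ.≤-trans (ℕ.≤-reflexive (ℕ.+-identityʳ ‖ eval μ e ‖)) (digits≤cost μ e)))
query≤time ⇓ask = z≤n

infix 4 _⊢_,_⇓_within_

_⊢_,_⇓_within_ : Oracle → Program → State → State → ℕ → Set
O ⊢ p , s ⇓ s′ within b = ∃[ t ] (O ⊢ p , s ⇓ s′ [ t ]) × t ≤ b

infixr 5 _then_

_then_ : ∀ {O p q s s′ s″ b c} → O ⊢ p , s ⇓ s′ within b → O ⊢ q , s′ ⇓ s″ within c →
  O ⊢ p ⨾ q , s ⇓ s″ within b + c
(t , p , t≤) then (t′ , q , t′≤) = t + t′ , ⇓seq p q , ℕ.+-mono-≤ t≤ t′≤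

emits : List Expr → Program
emits = foldr (λ e p → emit e ⨾ p) skip

emitsPrice : List Expr → ℕ
emitsPrice = foldr (λ e n → price e + n) 1

module _ {O : Oracle} {L : ℕ} (1≤L : 1 ≤ L) where

  set-within : ∀ {a i e μ q} → Fits L μ →
    O ⊢ set a i e , ⟨ μ , q ⟩ ⇓ ⟨ write a (eval μ i) (eval μ e) μ , q ⟩
      within (price i + price e) * L
  set-within {i = i} {e} fits = _ , ⇓set , ℕ.≤-trans
    (ℕ.+-mono-≤ (cost-price L 1≤L fits i) (cost-price L 1≤L fits e))
    (ℕ.≤-reflexive (sym (ℕ.*-distribʳ-+ L (price i) (price e))))

  emits-within : ∀ es {μ q} → Fits L μ →
    O ⊢ emits es , ⟨ μ , q ⟩ ⇓ ⟨ μ , q ++ map (eval μ) es ⟩ within emitsPrice es * L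
  emits-within [] {μ} {q} fits =
    1 , subst (λ q′ → O ⊢ skip , ⟨ μ , q ⟩ ⇓ ⟨ μ , q′ ⟩ [ 1 ]) (sym (List.++-identityʳ q)) ⇓skip
      , ℕ.≤-trans 1≤L (ℕ.≤-reflexive (sym (ℕ.*-identityˡ L)))
  emits-within (e ∷ es) {μ} {q} fits =
    let t , run , t≤ = emits-within es {μ} {q ++ [ eval μ e ]} fits in
    cost μ e + t
    , subst (λ q′ → O ⊢ emits (e ∷ es) , ⟨ μ , q ⟩ ⇓ ⟨ μ , q′ ⟩ [ cost μ e + t ])
        (List.++-assoc q [ eval μ e ] (map (eval μ) es)) (⇓seq ⇓emit run)
    , ℕ.≤-trans (ℕ.+-mono-≤ (cost-price L 1≤L fits e) t≤)
        (ℕ.≤-reflexive (sym (ℕ.*-distribʳ-+ L (price e) (emitsPrice es))))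

  module _ (Inv : ℕ → State → Set) {cond : Expr} {body : Program} (N b : ℕ)
    (fits      : ∀ {j μ q} → Inv j ⟨ μ , q ⟩ → Fits L μ)
    (condition : ∀ {j μ q} → Inv j ⟨ μ , q ⟩ → eval μ cond ≡ N ∸ j)
    (step      : ∀ {j μ q} → j < N → Inv j ⟨ μ , q ⟩ →
                 ∃[ s ] (O ⊢ body , ⟨ μ , q ⟩ ⇓ s within b) × Inv (suc j) s)
    where

    private
      c : ℕ
      c = price cond * L

    -- `j` rounds are done and `k` remain. The condition has the value `N ∸ j`, so it vanishes
    -- exactly when no round remains; the last `c` pays for that final test.
    iterations : ∀ k {j s} → j + k ≡ N → Inv j s →
      ∃[ s′ ] (O ⊢ while cond body , s ⇓ s′ within (k * (c + b) + c)) × Inv N s′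
    iterations zero {j} {⟨ μ , q ⟩} eq inv with refl ← trans (sym (ℕ.+-identityʳ j)) eq =
      _ , (_ , ⇓stop (trans (condition inv) (ℕ.n∸n≡0 N)) , cost-price L 1≤L (fits inv) cond) , inv
    iterations (suc k) {j} {⟨ μ , q ⟩} eq inv =
      let s₁ , (t , run , t≤) , inv₁ = step j<N inv
          s₂ , (t′ , runs , t′≤) , inv₂ = iterations k (trans (sym (ℕ.+-suc j k)) eq) inv₁
      in s₂ , (_ , ⇓loop cond≢0 run runs , ℕ.≤-trans
           (ℕ.+-mono-≤ (ℕ.+-mono-≤ (cost-price L 1≤L (fits inv) cond) t≤) t′≤)
           (ℕ.≤-reflexive (sym (ℕ.+-assoc (c + b) (k * (c + b)) c)))) , inv₂
      where
      j<N : j < N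
      j<N = subst (j <_) eq (ℕ.m<m+n j (s≤s z≤n))
      cond≢0 : eval μ cond ≢ 0
      cond≢0 eq′ = ℕ.<⇒≱ j<N (ℕ.m∸n≡0⇒m≤n (trans (sym (condition inv)) eq′))

    while-within : ∀ {s} → Inv 0 s →
      ∃[ s′ ] (O ⊢ while cond body , s ⇓ s′ within (N * (c + b) + c)) × Inv N s′
    while-within = iterations N refl

-- Encodings

-- The output of a loop after `j` rounds when round `i` emits `F i`; the loop invariants describe
-- the query in this form.
prefix : ∀ {n} → (Fin n → List ℕ) → ℕ → List ℕ
prefix F j = concat (take j (tabulate F))

prefix-suc : ∀ {n} (F : Fin n → List ℕ) i → prefix F (suc (toℕ i)) ≡ prefix F (toℕ i) ++ F i
prefix-suc F i = trans (cong concat (List.take-suc-tabulate F i))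
  (trans (sym (List.concat-++ (take (toℕ i) (tabulate F)) [ F i ]))
    (cong (prefix F (toℕ i) ++_) (List.++-identityʳ (F i))))

prefix-all : ∀ {n} (F : Fin n → List ℕ) → prefix F n ≡ concat (tabulate F)
prefix-all {n} F = cong concat (List.take-all n (tabulate F)
    (ℕ.≤-reflexive (List.length-tabulate F)))

tabulate-↑ : ∀ {A : Set} m {n} (f : Fin (m + n) → A) →
  tabulate f ≡ tabulate (f ∘ (_↑ˡ n)) ++ tabulate (f ∘ (m ↑ʳ_))
tabulate-↑ zero    f = refl
tabulate-↑ (suc m) f = cong (f 0F ∷_) (tabulate-↑ m (f ∘ Fin.suc))

tabulate-combine : ∀ {A : Set} m {k} (f : Fin (m * k) → A) →
  tabulate f ≡ concat (tabulate λ (i : Fin m) → tabulate λ (j : Fin k) → f (combine i j))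
tabulate-combine zero        f = refl
tabulate-combine (suc m) {k} f = trans (tabulate-↑ k f)
  (cong (tabulate (f ∘ (_↑ˡ m * k)) ++_) (tabulate-combine m (f ∘ (k ↑ʳ_))))

concat-tabulate-combine : ∀ {A : Set} m {k} (F : Fin (m * k) → List A) →
  concat (tabulate F) ≡
  concat (tabulate λ (i : Fin m) → concat (tabulate λ (j : Fin k) → F (combine i j)))
concat-tabulate-combine {A} m {k} F = trans (cong concat (tabulate-combine m F))
  (trans (sym (List.concat-concat (tabulate rows))) (cong concat (List.map-tabulate rows concat)))
  where
  rows : Fin m → List (List A)
  rows i = tabulate λ (j : Fin k) → F (combine i j)

concat-tabulate-[_] : ∀ {A : Set} {n} (f : Fin n → A) → concat (tabulate λ i → [ f i ]) ≡ tabulate f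
concat-tabulate-[ f ] = trans (cong concat (sym (List.map-tabulate f [_])))
    (List.concat-map-[ tabulate f ])

module Encoding {G} (slots : FourSlots G) where
  open Graph G
  open FourSlots slots
  open Gadgets slots

  -- The form in which the program obtains an end number: outer ends are looked up in a table, inner
  -- ends are numbered after the old ones, eight per gadget.
  number : Vertex → Local → ℕ
  number v (inj₁ i) = toℕ (slot v i)
  number v (inj₂ j) = 2 * (#E + (4 * toℕ v + toℕ (quotient {4} 2 j))) + toℕ (remainder {4} 2 j)

  toℕ-global : ∀ v l → toℕ (global v l) ≡ number v l
  toℕ-global v (inj₁ i) =
    trans (Fin.toℕ-combine (edge (slot v i) ↑ˡ #V * 4) (remainder {#E} 2 (slot v i)))
    (trans (cong (λ e → 2 * e + toℕ (remainder {#E} 2 (slot v i))) (Fin.toℕ-↑ˡ (edge (slot v i))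
        (#V * 4)))
    (trans (sym (Fin.toℕ-combine (edge (slot v i)) (remainder {#E} 2 (slot v i))))
      (cong toℕ (end-combine (slot v i)))))
  toℕ-global v (inj₂ j) =
    trans (Fin.toℕ-combine (#E ↑ʳ combine v (quotient {4} 2 j)) (remainder {4} 2 j))
    (cong (λ e → 2 * e + toℕ (remainder {4} 2 j))
      (trans (Fin.toℕ-↑ʳ #E (combine v (quotient {4} 2 j)))
        (cong (#E +_) (Fin.toℕ-combine v (quotient {4} 2 j)))))

  vertexNumber : Vertex → Local → ℕ
  vertexNumber v l = 3 * toℕ v + toℕ (block l)

  externalVertices : End → List ℕ
  externalVertices h = [ vertexNumber (vertex h) (inj₁ (rank h)) ]

  internalVertices : Vertex → List ℕ
  internalVertices v = map (λ j → vertexNumber v (inj₂ j)) (allFin 8)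

  orderings : Vertex → List ℕ
  orderings v = concatMap (λ k → 4 ∷ map (λ p → number v (at k p)) (allFin 4)) (allFin 3)

  private
    vertexNumber′ : End′ → ℕ
    vertexNumber′ h = toℕ (G′.vertex h)

  vertexNumber-external : ∀ h → vertexNumber′ (external h) ≡ vertexNumber (vertex h) (inj₁ (rank h))
  vertexNumber-external h = trans (cong (toℕ ∘ vertexOf) (local-external h))
      (Fin.toℕ-combine (vertex h) _)

  vertexNumber-internal : ∀ v j → vertexNumber′ (internal v j) ≡ vertexNumber v (inj₂ j)
  vertexNumber-internal v j = trans (cong (toℕ ∘ vertexOf) (local-global v (inj₂ j)))
      (Fin.toℕ-combine v _)

  external-combine : ∀ (e : Fin #E) (r : Fin 2) → external (combine e r) ≡ combine (e ↑ˡ #V * 4) r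
  external-combine e r = cong₂ (λ e r → combine (e ↑ˡ #V * 4) r)
    (cong proj₁ (Fin.remQuot-combine e r)) (cong proj₂ (Fin.remQuot-combine e r))

  encode-vertices : map vertexNumber′ (allFin (#E′ * 2)) ≡
    concat (tabulate externalVertices) ++ concat (tabulate internalVertices)
  encode-vertices =
    trans (List.map-tabulate id vertexNumber′)
    (trans (tabulate-combine #E′ vertexNumber′)
    (trans (cong concat (tabulate-↑ #E edgeBlock))
    (trans (sym (List.concat-++ (tabulate (edgeBlock ∘ (_↑ˡ #V * 4)))
        (tabulate (edgeBlock ∘ (#E ↑ʳ_)))))
    (cong₂ _++_ old new))))
    where
    edgeBlock : Fin #E′ → List ℕ
    edgeBlock e = tabulate λ (r : Fin 2) → vertexNumber′ (combine e r)
    old : concat (tabulate (edgeBlock ∘ (_↑ˡ #V * 4))) ≡ concat (tabulate externalVertices)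
    old = trans (cong concat (List.tabulate-cong λ e → List.tabulate-cong λ r →
        trans (cong vertexNumber′ (sym (external-combine e r)))
            (vertexNumber-external (combine e r))))
      (trans (sym (tabulate-combine #E (λ h → vertexNumber (vertex h) (inj₁ (rank h)))))
        (sym (concat-tabulate-[ (λ h → vertexNumber (vertex h) (inj₁ (rank h))) ])))
    new : concat (tabulate (edgeBlock ∘ (#E ↑ʳ_))) ≡ concat (tabulate internalVertices)
    new = trans (concat-tabulate-combine #V (edgeBlock ∘ (#E ↑ʳ_)))
      -- Four edges with two ends each unfold by computation to the list of the eight inner ends.
      (cong concat (List.tabulate-cong λ v →
        List.map-cong {f = λ j → vertexNumber′ (internal v j)} (vertexNumber-internal v)
            (allFin 8)))

  private
    module M′ = RotationMap map′

  encode-orderings : concatMap (λ x → length (M′.ordering x) ∷ map toℕ (M′.ordering x)) (allFin #V′)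
    ≡ concat (tabulate orderings)
  encode-orderings =
    trans (cong concat (List.map-tabulate id vertexBlock))
    (trans (concat-tabulate-combine #V vertexBlock)
    (cong concat (List.tabulate-cong λ v →
        cong concat (List.map-cong {f = λ k → vertexBlock (combine v k)}
      (λ k → cong (4 ∷_) (List.map-cong {f = λ p → toℕ (slot′ (combine v k) p)}
        (λ p → trans (cong toℕ (slot′-combine v k p)) (toℕ-global v (at k p))) (allFin 4)))
            (allFin 3)))))
    where
    vertexBlock : Fin #V′ → List ℕ
    vertexBlock x = length (M′.ordering x) ∷ map toℕ (M′.ordering x)

  encodeMap-map′ : encodeMap map′ ≡ #V′ ∷ #E′ ∷
    (concat (tabulate externalVertices) ++ concat (tabulate internalVertices)) ++
        concat (tabulate orderings)
  encodeMap-map′ = cong₂ (λ xs ys → #V′ ∷ #E′ ∷ xs ++ ys) encode-vertices encode-orderings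

-- Ranks as numbers of earlier ends

index-++ : ∀ {A : Set} (xs : List A) {x ys} → Unique (xs ++ x ∷ ys) →
  (x∈ : x ∈ xs ++ x ∷ ys) → toℕ (index x∈) ≡ length xs
index-++ []       _        (here _)   = refl
index-++ []       (x∉ ∷ _) (there x∈) = contradiction refl (All.lookup x∉ x∈)
index-++ (y ∷ xs) (y∉ ∷ _) (here refl) = contradiction refl (All.lookup y∉ (∈-++⁺ʳ xs (here refl)))
index-++ (y ∷ xs) (_ ∷ u)  (there x∈) = cong suc (index-++ xs u x∈)

drop-tabulate : ∀ {A : Set} {n} (f : Fin n → A) i →
  drop (toℕ i) (tabulate f) ≡ f i ∷ drop (suc (toℕ i)) (tabulate f)
drop-tabulate f 0F          = refl
drop-tabulate f (Fin.suc i) = drop-tabulate (f ∘ Fin.suc) i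

module Counters (G : Graph) (regular : (4 -Regular) G) where
  open Graph G
  open FourSlots (fourSlots G regular) using (rank)

  seen : ℕ → Vertex → List End
  seen j v = filter (λ h → vertex h Fin.≟ v) (take j (allFin (#E * 2)))

  counter : ℕ → Vertex → ℕ
  counter j v = length (seen j v)

  seen-suc : ∀ h v → seen (suc (toℕ h)) v ≡ seen (toℕ h) v ++ filter (λ h → vertex h Fin.≟ v) [ h ]
  seen-suc h v = trans (cong (filter (λ h → vertex h Fin.≟ v)) (List.take-suc-tabulate id h))
    (List.filter-++ (λ h → vertex h Fin.≟ v) (take (toℕ h) (allFin _)) [ h ])

  counter-suc-at : ∀ h → counter (suc (toℕ h)) (vertex h) ≡ suc (counter (toℕ h) (vertex h))
  counter-suc-at h = trans (cong length (seen-suc h (vertex h)))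
    (trans (List.length-++ (seen (toℕ h) (vertex h)))
      (trans (cong (λ xs → counter (toℕ h) (vertex h) + length xs)
          (List.filter-accept (λ h′ → vertex h′ Fin.≟ vertex h) {x = h} {xs = []} refl))
        (ℕ.+-comm _ 1)))

  counter-suc-off : ∀ h {v} → vertex h ≢ v → counter (suc (toℕ h)) v ≡ counter (toℕ h) v
  counter-suc-off h {v} h≢v = trans (cong length (seen-suc h v))
    (trans (List.length-++ (seen (toℕ h) v))
      (trans (cong (λ xs → counter (toℕ h) v + length xs)
          (List.filter-reject (λ h′ → vertex h′ Fin.≟ v) {x = h} {xs = []} h≢v))
        (ℕ.+-identityʳ _)))

  -- Cut at `h`, the list `endsAt` consists of the earlier ends at the vertex, `h` itself, and later
  -- ones. It has no repetition, so the index of `h` is the number of earlier ends.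
  counter-rank : ∀ h → counter (toℕ h) (vertex h) ≡ toℕ (rank h)
  counter-rank h = sym (trans (Fin.toℕ-cast _ (index h∈)) (go h∈ endsAt-split))
    where
    at? = λ h′ → vertex h′ Fin.≟ vertex h
    h∈ : h ∈ endsAt (vertex h)
    h∈ = ∈-filter⁺ at? (∈-allFin h) refl
    later : List End
    later = filter at? (drop (suc (toℕ h)) (allFin _))
    endsAt-split : endsAt (vertex h) ≡ seen (toℕ h) (vertex h) ++ h ∷ later
    endsAt-split = trans (cong (filter at?) (sym (List.take++drop≡id (toℕ h) (allFin _))))
      (trans (List.filter-++ at? (take (toℕ h) (allFin _)) _)
        (cong (seen (toℕ h) (vertex h) ++_)
          (trans (cong (filter at?) (drop-tabulate id h)) (List.filter-accept at? refl))))
    go : ∀ {xs} (x∈ : h ∈ xs) → xs ≡ seen (toℕ h) (vertex h) ++ h ∷ later →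
      toℕ (index x∈) ≡ counter (toℕ h) (vertex h)
    go x∈ refl = index-++ (seen (toℕ h) (vertex h))
      (subst Unique endsAt-split (Unique.filter⁺ at? (Unique.allFin⁺ _))) x∈

-- The reduction

-- Array 3 counts the ends seen so far at each vertex, array 4 holds the end with
-- rank i at v in cell 4 v + i, arrays 2, 5 and 6 hold the loop counters, array 7
-- the power of two and array 8 the answer of the oracle.
numVertices numEdges : Expr
numVertices = get 0 (lit 0)
numEdges    = get 0 (lit 1)

currentEnd currentVertex currentCount : Expr
currentEnd    = get 2 (lit 0)
-- The offset 2 skips `#V` and `#E` at the head of the input.
currentVertex = get 0 (op add (lit 2) currentEnd)
currentCount  = get 3 currentVertex

-- The ranks 0, 1, 2, 3 belong to the blocks 0, 1, 2, 2.
attachment : Expr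
attachment = op add (op mul (lit 3) currentVertex)
    (op sub currentCount (op div currentCount (lit 3)))

endsCondition : Expr
endsCondition = op sub (op mul numEdges (lit 2)) currentEnd

endsBody : Program
endsBody = emits (attachment ∷ [])
  ⨾ set 4 (op add (op mul (lit 4) currentVertex) currentCount) currentEnd
  ⨾ set 3 currentVertex (op add (lit 1) currentCount)
  -- The index advances last, because the preceding instructions read the current vertex through it.
  ⨾ set 2 (lit 0) (op add (lit 1) currentEnd)

internalCondition : Expr
internalCondition = op sub numVertices (get 5 (lit 0))

internalEmits : List Expr
internalEmits = map (λ j → op add (op mul (lit 3) (get 5 (lit 0))) (lit (toℕ (block (inj₂ j)))))
    (allFin 8)

internalBody : Program
internalBody = emits internalEmits ⨾ set 5 (lit 0) (op add (lit 1) (get 5 (lit 0)))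

orderingsCondition : Expr
orderingsCondition = op sub numVertices (get 6 (lit 0))

numberExpr : Local → Expr
numberExpr (inj₁ i) = get 4 (op add (op mul (lit 4) (get 6 (lit 0))) (lit (toℕ i)))
numberExpr (inj₂ j) = op add
  (op mul (lit 2) (op add numEdges
    (op add (op mul (lit 4) (get 6 (lit 0))) (lit (toℕ (quotient {4} 2 j))))))
  (lit (toℕ (remainder {4} 2 j)))

orderingsEmits : List Expr
orderingsEmits = concatMap (λ k → lit 4 ∷ map (λ p → numberExpr (at k p)) (allFin 4)) (allFin 3)

orderingsBody : Program
orderingsBody = emits orderingsEmits
  -- Doubling once per vertex of `G` produces the divisor 2 ^ `#V`.
  ⨾ set 7 (lit 0) (op mul (lit 2) (get 7 (lit 0)))
  ⨾ set 6 (lit 0) (op add (lit 1) (get 6 (lit 0)))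

headerEmits : List Expr
headerEmits = op mul numVertices (lit 3) ∷ op add numEdges (op mul numVertices (lit 4)) ∷ []

buildQuery : Program
buildQuery = emits headerEmits
  ⨾ set 7 (lit 0) (lit 1)
  ⨾ while endsCondition endsBody
  ⨾ while internalCondition internalBody
  ⨾ while orderingsCondition orderingsBody

quotientExpr : Expr
quotientExpr = op div (get 8 (lit 0)) (get 7 (lit 0))

reduction : Program
reduction = buildQuery ⨾ ask 8 (lit 0) ⨾ set 1 (lit 0) quotientExpr

setPrice : Expr → Expr → ℕ
setPrice i e = price i + price e

loopTime : ℕ → ℕ → ℕ → ℕ → ℕ
loopTime c b L N = N * (c * L + b) + c * L

endsBodyTime internalBodyTime orderingsBodyTime : ℕ → ℕ
endsBodyTime L = emitsPrice (attachment ∷ []) * L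
  + (setPrice (op add (op mul (lit 4) currentVertex) currentCount) currentEnd * L
  + (setPrice currentVertex (op add (lit 1) currentCount) * L
  + setPrice (lit 0) (op add (lit 1) currentEnd) * L))
internalBodyTime L = emitsPrice internalEmits * L
  + setPrice (lit 0) (op add (lit 1) (get 5 (lit 0))) * L
orderingsBodyTime L = emitsPrice orderingsEmits * L
  + (setPrice (lit 0) (op mul (lit 2) (get 7 (lit 0))) * L
  + setPrice (lit 0) (op add (lit 1) (get 6 (lit 0))) * L)

-- `N` bounds the rounds of all three loops, so that one number, the input size, can stand for both
-- `#E` * 2 and `#V`.
buildTime : ℕ → ℕ → ℕ
buildTime L N = emitsPrice headerEmits * L
  + (setPrice (lit 0) (lit 1) * L
  + (loopTime (price endsCondition) (endsBodyTime L) L N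
  + (loopTime (price internalCondition) (internalBodyTime L) L N
  + loopTime (price orderingsCondition) (orderingsBodyTime L) L N)))

-- The map has N ≤ 3 n edge-ends, hence at most N ^ N ≤ 2 ^ (3 n * (3 n)) A-trails.
wordLength : ℕ → ℕ
wordLength n = 2 + (n + 3 * n * (3 * n))

-- The second `buildTime` bounds the length of the query, which is charged when it is submitted; 1 +
-- `wordLength n` pays for the digits of the answer.
totalTime : ℕ → ℕ
totalTime n = buildTime (wordLength n) n
  + ((1 + buildTime (wordLength n) n + (1 + wordLength n)) + setPrice (lit 0) quotientExpr
      * wordLength n)

poly-word : PolyBounded wordLength
poly-word = poly-+ (poly-const 2) (poly-+ poly-id (poly-* 3n 3n))
  where
  3n : PolyBounded (λ n → 3 * n)
  3n = poly-* (poly-const 3) poly-id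

poly-scale : ∀ c → PolyBounded (λ n → c * wordLength n)
poly-scale c = poly-* (poly-const c) poly-word

poly-loop : ∀ c {b} → PolyBounded b → PolyBounded (λ n → loopTime c (b n) (wordLength n) n)
poly-loop c body = poly-+ (poly-* poly-id (poly-+ (poly-scale c) body)) (poly-scale c)

poly-endsBody : PolyBounded (λ n → endsBodyTime (wordLength n))
poly-endsBody = poly-+ (poly-scale (emitsPrice (attachment ∷ [])))
  (poly-+ (poly-scale (setPrice (op add (op mul (lit 4) currentVertex) currentCount) currentEnd))
  (poly-+ (poly-scale (setPrice currentVertex (op add (lit 1) currentCount)))
  (poly-scale (setPrice (lit 0) (op add (lit 1) currentEnd)))))

poly-internalBody : PolyBounded (λ n → internalBodyTime (wordLength n))
poly-internalBody = poly-+ (poly-scale (emitsPrice internalEmits))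
  (poly-scale (setPrice (lit 0) (op add (lit 1) (get 5 (lit 0)))))

poly-orderingsBody : PolyBounded (λ n → orderingsBodyTime (wordLength n))
poly-orderingsBody = poly-+ (poly-scale (emitsPrice orderingsEmits))
  (poly-+ (poly-scale (setPrice (lit 0) (op mul (lit 2) (get 7 (lit 0)))))
  (poly-scale (setPrice (lit 0) (op add (lit 1) (get 6 (lit 0))))))

poly-build : PolyBounded (λ n → buildTime (wordLength n) n)
poly-build =
  poly-+ (poly-scale (emitsPrice headerEmits))
  (poly-+ (poly-scale (setPrice (lit 0) (lit 1)))
  (poly-+ (poly-loop (price endsCondition) poly-endsBody)
  (poly-+ (poly-loop (price internalCondition) poly-internalBody)
  (poly-loop (price orderingsCondition) poly-orderingsBody))))

poly-total : PolyBounded totalTime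
poly-total = poly-+ poly-build
  (poly-+ (poly-+ (poly-+ (poly-const 1) poly-build) (poly-+ (poly-const 1) poly-word))
    (poly-scale (setPrice (lit 0) quotientExpr)))

-- Memory cells and the size of the input

≡ᵇ-refl : ∀ n → (n ≡ᵇ n) ≡ true
≡ᵇ-refl zero    = refl
≡ᵇ-refl (suc n) = ≡ᵇ-refl n

write-at : ∀ a i v μ → write a i v μ a i ≡ v
write-at a i v μ rewrite ≡ᵇ-refl a | ≡ᵇ-refl i = refl

write-off : ∀ a {i j} v μ → i ≢ j → write a i v μ a j ≡ μ a j
write-off a {i} {j} v μ i≢j with a ≡ᵇ a | i ≡ᵇ j in eq
... | false | _     = refl
... | true  | false = refl
... | true  | true  = contradiction (ℕ.≡ᵇ⇒≡ i j (subst T (sym eq) _)) i≢j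

nth-map-allFin : ∀ {n} (f : Fin n → ℕ) i → nth (map f (allFin n)) (toℕ i) ≡ f i
nth-map-allFin {n} f i = trans (cong (λ xs → nth xs (toℕ i)) (List.map-tabulate id f)) (go f i)
  where
  go : ∀ {n} (f : Fin n → ℕ) i → nth (tabulate f) (toℕ i) ≡ f i
  go f 0F          = refl
  go f (Fin.suc i) = go (f ∘ Fin.suc) i

nth-map-≤ : ∀ {A : Set} {b} (f : A → ℕ) → (∀ x → f x ≤ b) → ∀ xs i → nth (map f xs) i ≤ b
nth-map-≤ f f≤ []       i       = z≤n
nth-map-≤ f f≤ (x ∷ xs) zero    = f≤ x
nth-map-≤ f f≤ (x ∷ xs) (suc i) = nth-map-≤ f f≤ xs i

length≤digits : ∀ xs → length xs ≤ ‖ xs ‖*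
length≤digits []       = z≤n
length≤digits (x ∷ xs) = s≤s (ℕ.≤-trans (length≤digits xs) (ℕ.m≤n+m _ _))

div-cancel : ∀ m n .{{_ : NonZero n}} → ⟦ div ⟧ (m * n) n ≡ m
div-cancel m (suc n) = ℕ.m*n/n≡m m (suc n)

below : ∀ {N} {P : ℕ → Set} → (∀ (h : Fin N) → P (toℕ h)) → ∀ {j} → j < N → P j
below {P = P} p j<N = subst P (Fin.toℕ-fromℕ< j<N) (p (fromℕ< j<N))

blockOfRank : ∀ (r : Fin 4) → toℕ r ∸ toℕ r / 3 ≡ toℕ (block (inj₁ r))
blockOfRank 0F = refl
blockOfRank 1F = refl
blockOfRank 2F = refl
blockOfRank 3F = refl

-- The execution depends on the word length only through these inequalities. The counters at a
-- vertex reach 4 = 2 ^ 2, hence `2≤L`; `vertices≤L` covers both the vertex indices and the power 2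
-- ^ `#V`.
record WordBound (G : Graph) (regular : (4 -Regular) G) (L : ℕ) : Set where
  open Graph G
  field
    2≤L         : 2 ≤ L
    ends≤L      : #E * 2 ≤ L
    vertices≤L  : #V ≤ L
    answer-fits : #ATrails (Gadgets.map′ (fourSlots G regular)) ≤ 2 ^ L

module _ (G : Graph) (regular : (4 -Regular) G) where
  open Graph G
  open FourSlots (fourSlots G regular) using (slot; rank; vertex-slot; rank-slot)
  open Gadgets (fourSlots G regular) using (#E′; map′)

  ends≤digits : #E * 2 ≤ ‖ encodeGraph G ‖*
  ends≤digits = ℕ.≤-trans (ℕ.m≤n+m (#E * 2) 2)
    (ℕ.≤-trans (ℕ.≤-reflexive (cong (2 +_) (sym length-vertices))) (length≤digits (encodeGraph G)))
    where
    length-vertices : length (map (λ h → toℕ (vertex h)) (allFin (#E * 2))) ≡ #E * 2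
    length-vertices = trans (List.length-map (λ h → toℕ (vertex h)) (allFin (#E * 2)))
        (List.length-tabulate id)

  -- The input states `#V` in binary, and a binary number may be exponential in its length.
  -- Regularity gives each vertex four ends of its own, and each end occupies an entry of the input.
  slots≤ends : #V * 4 ≤ #E * 2
  slots≤ends = Fin.injective⇒≤ {f = λ k → slot (quotient {#V} 4 k) (remainder {#V} 4 k)}
    λ {k} {k′} eq →
    trans (sym (Fin.combine-remQuot {#V} 4 k)) (trans (cong₂ combine
        (trans (sym (vertex-slot (quotient {#V} 4 k) (remainder {#V} 4 k)))
          (trans (cong vertex eq) (vertex-slot (quotient {#V} 4 k′) (remainder {#V} 4 k′))))
        (trans (sym (rank-slot (quotient {#V} 4 k) (remainder {#V} 4 k)))
          (trans (cong rank eq) (rank-slot (quotient {#V} 4 k′) (remainder {#V} 4 k′)))))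
      (Fin.combine-remQuot {#V} 4 k′))

  wordBound : ∀ n → #E * 2 ≤ n → WordBound G regular (wordLength n)
  wordBound n ends≤n = record
    { 2≤L         = ℕ.m≤m+n 2 _
    ; ends≤L      = ℕ.≤-trans ends≤n n≤L
    ; vertices≤L  = ℕ.≤-trans (ℕ.m≤m*n #V 4) (ℕ.≤-trans slots≤ends (ℕ.≤-trans ends≤n n≤L))
    ; answer-fits = begin
        #ATrails map′           ≤⟨ List.length-filter (λ c → RotationMap.isATrail? map′
            (finToFun c)) (allFin (N ^ N)) ⟩
        length (allFin (N ^ N)) ≡⟨ List.length-tabulate id ⟩
        N ^ N                   ≤⟨ ℕ.^-monoˡ-≤ N (n≤2^n N) ⟩
        (2 ^ N) ^ N             ≡⟨ ℕ.^-*-assoc 2 N N ⟩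
        2 ^ (N * N)             ≤⟨ ℕ.^-monoʳ-≤ 2 (ℕ.≤-trans (ℕ.*-mono-≤ N≤3n N≤3n)
                                     (ℕ.≤-trans (ℕ.m≤n+m (3 * n * (3 * n)) n) (ℕ.m≤n+m _ 2))) ⟩
        2 ^ wordLength n        ∎
    }
    where
    open ℕ.≤-Reasoning
    N = #E′ * 2
    n≤L : n ≤ wordLength n
    n≤L = ℕ.≤-trans (ℕ.m≤m+n n _) (ℕ.m≤n+m _ 2)
    -- There are at most `n` old ends; each gadget adds eight, twice the four old ends at its
    -- vertex.
    N≤3n : N ≤ 3 * n
    N≤3n = begin
      (#E + #V * 4) * 2         ≡⟨ ℕ.*-distribʳ-+ 2 #E (#V * 4) ⟩
      #E * 2 + #V * 4 * 2       ≤⟨ ℕ.+-mono-≤ ends≤n (ℕ.*-monoˡ-≤ 2 (ℕ.≤-trans slots≤ends ends≤n)) ⟩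
      n + n * 2                 ≡⟨ cong (n +_) (ℕ.*-comm n 2) ⟩
      3 * n                     ∎

-- Execution of the program

module Run (O : Oracle) (G : Graph) (regular : (4 -Regular) G) {L : ℕ} (wordBound : WordBound G
    regular L) where
  open Graph G
  open WordBound wordBound
  slots : FourSlots G
  slots = fourSlots G regular
  open FourSlots slots using (slot; rank; slot-rank; vertex-slot; rank-slot)
  open Gadgets slots using (#V′; #E′; map′; regular′)
  open Encoding slots
  open Counters G regular

  input : List ℕ
  input = encodeGraph G

  1≤L : 1 ≤ L
  1≤L = ℕ.≤-trans (s≤s z≤n) 2≤L

  small : ∀ {m} → m ≤ L → m ≤ 2 ^ L
  small m≤L = ℕ.≤-trans m≤L (n≤2^n L)

  header : List ℕ
  header = #V′ ∷ #E′ ∷ []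

  record HasInput (μ : Memory) : Set where
    field
      inputArray : ∀ i → μ 0 i ≡ nth input i
      fits       : Fits L μ

  record Inv₁ (j : ℕ) (s : State) : Set where
    private
      μ = State.memory s
    field
      hasInput : HasInput μ
      index₁   : μ 2 0 ≡ j
      counts   : ∀ v → μ 3 (toℕ v) ≡ counter j v
      placed   : ∀ h → toℕ h < j → μ 4 (4 * toℕ (vertex h) + toℕ (rank h)) ≡ toℕ h
      index₂   : μ 5 0 ≡ 0
      index₃   : μ 6 0 ≡ 0
      power    : μ 7 0 ≡ 1
      query    : State.query s ≡ header ++ prefix externalVertices j

  record Inv₂ (j : ℕ) (s : State) : Set where
    private
      μ = State.memory s
    field
      hasInput  : HasInput μ
      slotTable : ∀ v i → μ 4 (4 * toℕ v + toℕ i) ≡ toℕ (slot v i)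
      index₂    : μ 5 0 ≡ j
      index₃    : μ 6 0 ≡ 0
      power     : μ 7 0 ≡ 1
      query     : State.query s ≡ (header ++ concat (tabulate externalVertices)) ++
          prefix internalVertices j

  record Inv₃ (j : ℕ) (s : State) : Set where
    private
      μ = State.memory s
    field
      hasInput  : HasInput μ
      slotTable : ∀ v i → μ 4 (4 * toℕ v + toℕ i) ≡ toℕ (slot v i)
      index₃    : μ 6 0 ≡ j
      power     : μ 7 0 ≡ 2 ^ j
      query     : State.query s ≡
        ((header ++ concat (tabulate externalVertices)) ++ concat (tabulate internalVertices)) ++
            prefix orderings j

  open HasInput

  hasInput-write : ∀ {μ} a i v → v ≤ 2 ^ L → HasInput μ → HasInput (write (suc a) i v μ)
  hasInput-write a i v v≤ has = record
    { inputArray = inputArray has ; fits = fits-write {L} (suc a) i v v≤ (fits has) }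

  append : ∀ {m} (F : Fin m → List ℕ) {q q₀ xs} h → q ≡ q₀ ++ prefix F (toℕ h) → xs ≡ F h →
    q ++ xs ≡ q₀ ++ prefix F (suc (toℕ h))
  append F {q₀ = q₀} h refl refl = trans (List.++-assoc q₀ (prefix F (toℕ h)) (F h))
    (cong (q₀ ++_) (sym (prefix-suc F h)))

  -- The count read at the vertex of `h` is the number of earlier ends there, hence the rank of `h`.
  -- It yields both the gadget vertex to which `h` is attached and the table cell for `h`.
  step₁ : ∀ h {μ q} → Inv₁ (toℕ h) ⟨ μ , q ⟩ →
    ∃[ s ] (O ⊢ endsBody , ⟨ μ , q ⟩ ⇓ s within endsBodyTime L) × Inv₁ (suc (toℕ h)) s
  step₁ h {μ} {q} inv = _ , run , record
    { hasInput = has₃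
    ; index₁   = cong suc I≡
    ; counts   = counts′
    ; placed   = placed′
    ; index₂   = index₂
    ; index₃   = index₃
    ; power    = power
    ; query    = append externalVertices h query (cong [_] (cong₂ (λ x c → 3 * x + c) X≡
        (trans (cong (λ c → c ∸ c / 3) C≡) (blockOfRank (rank h)))))
    }
    where
    open Inv₁ inv
    I X C : ℕ
    I = μ 2 0
    X = μ 0 (2 + I)
    C = μ 3 X
    I≡ : I ≡ toℕ h
    I≡ = index₁
    X≡ : X ≡ toℕ (vertex h)
    X≡ = trans (cong (λ i → μ 0 (2 + i)) I≡) (trans (inputArray hasInput (2 + toℕ h))
      (nth-map-allFin (λ h → toℕ (vertex h)) h))
    C≡counter : C ≡ counter (toℕ h) (vertex h)
    C≡counter = trans (cong (μ 3) X≡) (counts (vertex h))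
    C≡ : C ≡ toℕ (rank h)
    C≡ = trans C≡counter (counter-rank h)
    μ₁ μ₂ μ₃ : Memory
    μ₁ = write 4 (4 * X + C) I μ
    μ₂ = write 3 X (suc C) μ₁
    μ₃ = write 2 0 (suc I) μ₂
    I<ends : suc I ≤ #E * 2
    I<ends = ℕ.≤-trans (ℕ.≤-reflexive (cong suc I≡)) (Fin.toℕ<n h)
    has₁ : HasInput μ₁
    has₁ = hasInput-write 3 (4 * X + C) I (small (ℕ.≤-trans (ℕ.n≤1+n I) (ℕ.≤-trans I<ends ends≤L)))
        hasInput
    has₂ : HasInput μ₂
    has₂ = hasInput-write 2 X (suc C) (ℕ.≤-trans (ℕ.≤-reflexive (cong suc C≡))
      (ℕ.≤-trans (Fin.toℕ<n (rank h)) (ℕ.^-monoʳ-≤ 2 2≤L))) has₁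
    has₃ : HasInput μ₃
    has₃ = hasInput-write 1 0 (suc I) (small (ℕ.≤-trans I<ends ends≤L)) has₂
    run : O ⊢ endsBody , ⟨ μ , q ⟩ ⇓ ⟨ μ₃ , q ++ [ 3 * X + (C ∸ C / 3) ] ⟩ within endsBodyTime L
    run = emits-within 1≤L (attachment ∷ []) (fits hasInput)
      then set-within 1≤L {i = op add (op mul (lit 4) currentVertex) currentCount} {e = currentEnd}
          (fits hasInput)
      then set-within 1≤L {i = currentVertex} {e = op add (lit 1) currentCount} (fits has₁)
      then set-within 1≤L {i = lit 0} {e = op add (lit 1) currentEnd} (fits has₂)
    counts′ : ∀ v → μ₂ 3 (toℕ v) ≡ counter (suc (toℕ h)) v
    counts′ v with vertex h Fin.≟ v
    ... | yes refl = trans (cong (μ₂ 3) (sym X≡)) (trans (write-at 3 X (suc C) μ₁)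
      (trans (cong suc C≡counter) (sym (counter-suc-at h))))
    ... | no  h≢v  = trans (write-off 3 (suc C) μ₁
        (λ eq → h≢v (Fin.toℕ-injective (trans (sym X≡) eq))))
      (trans (counts v) (sym (counter-suc-off h h≢v)))
    cell : ∀ h → 4 * toℕ (vertex h) + toℕ (rank h) ≡ toℕ (combine (vertex h) (rank h))
    cell h = sym (Fin.toℕ-combine (vertex h) (rank h))
    -- Different ends have different cells, so the new entry overwrites no earlier one.
    cell-injective : ∀ h h′ → 4 * toℕ (vertex h) + toℕ (rank h) ≡
        4 * toℕ (vertex h′) + toℕ (rank h′) → h ≡ h′
    cell-injective h h′ eq =
      let v≡ , r≡ = Fin.combine-injective (vertex h) (rank h) (vertex h′) (rank h′)
            (Fin.toℕ-injective (trans (sym (cell h)) (trans eq (cell h′))))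
      in trans (sym (slot-rank h)) (trans (cong₂ slot v≡ r≡) (slot-rank h′))
    cell≡ : 4 * X + C ≡ 4 * toℕ (vertex h) + toℕ (rank h)
    cell≡ = cong₂ (λ x c → 4 * x + c) X≡ C≡
    placed′ : ∀ h′ → toℕ h′ < suc (toℕ h) → μ₁ 4 (4 * toℕ (vertex h′) + toℕ (rank h′)) ≡ toℕ h′
    placed′ h′ h′≤h with h Fin.≟ h′
    ... | yes refl = trans (cong (μ₁ 4) (sym cell≡)) (trans (write-at 4 (4 * X + C) I μ) I≡)
    ... | no  h≢h′ = trans (write-off 4 I μ
        (λ eq → h≢h′ (cell-injective h h′ (trans (sym cell≡) eq))))
      (placed h′ (ℕ.≤∧≢⇒< (ℕ.≤-pred h′≤h) (λ eq → h≢h′ (sym (Fin.toℕ-injective eq)))))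

  step₂ : ∀ v {μ q} → Inv₂ (toℕ v) ⟨ μ , q ⟩ →
    ∃[ s ] (O ⊢ internalBody , ⟨ μ , q ⟩ ⇓ s within internalBodyTime L) × Inv₂ (suc (toℕ v)) s
  step₂ v {μ} {q} inv = _ , run , record
    { hasInput  = hasInput-write 4 0 (suc (μ 5 0))
        (small (ℕ.≤-trans (ℕ.≤-reflexive (cong suc index₂))
        (ℕ.≤-trans (Fin.toℕ<n v) vertices≤L))) hasInput
    ; slotTable = slotTable
    ; index₂    = cong suc index₂
    ; index₃    = index₃
    ; power     = power
    ; query     = append internalVertices v query
        (cong (λ w → map (λ j → 3 * w + toℕ (block (inj₂ j))) (allFin 8)) index₂)
    }
    where
    open Inv₂ inv
    run : O ⊢ internalBody , ⟨ μ , q ⟩ ⇓ ⟨ write 5 0 (suc (μ 5 0)) μ , q ++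
        map (eval μ) internalEmits ⟩ within internalBodyTime L
    run = emits-within 1≤L internalEmits (fits hasInput)
      then set-within 1≤L {i = lit 0} {e = op add (lit 1) (get 5 (lit 0))} (fits hasInput)

  step₃ : ∀ v {μ q} → Inv₃ (toℕ v) ⟨ μ , q ⟩ →
    ∃[ s ] (O ⊢ orderingsBody , ⟨ μ , q ⟩ ⇓ s within orderingsBodyTime L) × Inv₃ (suc (toℕ v)) s
  step₃ v {μ} {q} inv = _ , run , record
    { hasInput  = hasInput-write 5 0 (suc (μ 6 0))
        (small (ℕ.≤-trans (ℕ.≤-reflexive (cong suc index₃))
        (ℕ.≤-trans (Fin.toℕ<n v) vertices≤L))) has₁
    ; slotTable = slotTable
    ; index₃    = cong suc index₃
    ; power     = cong (2 *_) power
    ; query     = append orderings v query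
        (trans (List.map-concatMap (eval μ) (λ k → lit 4 ∷ map (λ p → numberExpr (at k p))
            (allFin 4)) (allFin 3))
        (List.concatMap-cong (λ k → cong (4 ∷_)
            (List.map-cong {f = λ p → eval μ (numberExpr (at k p))} (λ p → number≡ (at k p))
                (allFin 4))) (allFin 3)))
    }
    where
    open Inv₃ inv
    number≡ : ∀ l → eval μ (numberExpr l) ≡ number v l
    number≡ (inj₁ i) = trans (cong (λ w → μ 4 (4 * w + toℕ i)) index₃) (slotTable v i)
    number≡ (inj₂ j) = cong₂ (λ e w → 2 * (e + (4 * w + toℕ (quotient {4} 2 j))) +
        toℕ (remainder {4} 2 j))
      (inputArray hasInput 1) index₃
    has₁ : HasInput (write 7 0 (2 * μ 7 0) μ)
    has₁ = hasInput-write 6 0 (2 * μ 7 0)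
      (ℕ.≤-trans (ℕ.≤-reflexive (cong (2 *_) power))
          (ℕ.^-monoʳ-≤ 2 (ℕ.≤-trans (Fin.toℕ<n v) vertices≤L))) hasInput
    run : O ⊢ orderingsBody , ⟨ μ , q ⟩ ⇓
      ⟨ write 6 0 (suc (μ 6 0)) (write 7 0 (2 * μ 7 0) μ) , q ++ map (eval μ) orderingsEmits ⟩
          within orderingsBodyTime L
    run = emits-within 1≤L orderingsEmits (fits hasInput)
      then set-within 1≤L {i = lit 0} {e = op mul (lit 2) (get 7 (lit 0))} (fits hasInput)
      then set-within 1≤L {i = lit 0} {e = op add (lit 1) (get 6 (lit 0))} (fits has₁)

  initialMemory : Memory
  initialMemory = State.memory (initial input)

  initial-hasInput : HasInput initialMemory
  initial-hasInput = record { inputArray = λ i → refl ; fits = fits₀ }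
    where
    fits₀ : Fits L initialMemory
    fits₀ zero    zero          = small vertices≤L
    fits₀ zero    (suc zero)    = small (ℕ.≤-trans (ℕ.m≤m*n #E 2) ends≤L)
    fits₀ zero    (suc (suc i)) = small
        (ℕ.≤-trans (nth-map-≤ (λ h → toℕ (vertex h)) (λ h → ℕ.<⇒≤ (Fin.toℕ<n (vertex h)))
            (allFin (#E * 2)) i) vertices≤L)
    fits₀ (suc a) i             = z≤n

  inv₁-initial : Inv₁ 0 ⟨ write 7 0 1 initialMemory , header ⟩
  inv₁-initial = record
    { hasInput = hasInput-write 6 0 1 (small 1≤L) initial-hasInput
    ; index₁   = refl
    ; counts   = λ v → refl
    ; placed   = λ h ()
    ; index₂   = refl
    ; index₃   = refl
    ; power    = refl
    ; query    = refl
    }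

  -- After the last round every end has been placed, in particular each `slot v i`, so the table is
  -- complete.
  inv₁⇒inv₂ : ∀ {s} → Inv₁ (#E * 2) s → Inv₂ 0 s
  inv₁⇒inv₂ {⟨ μ , q ⟩} inv = record
    { hasInput  = hasInput
    ; slotTable = λ v i → trans (cong₂ (λ v i → μ 4 (4 * toℕ v + toℕ i)) (sym (vertex-slot v i))
        (sym (rank-slot v i)))
        (placed (slot v i) (Fin.toℕ<n (slot v i)))
    ; index₂    = index₂
    ; index₃    = index₃
    ; power     = power
    ; query     = trans query (trans (cong (header ++_) (prefix-all externalVertices))
        (sym (List.++-identityʳ _)))
    }
    where open Inv₁ inv

  inv₂⇒inv₃ : ∀ {s} → Inv₂ #V s → Inv₃ 0 s
  inv₂⇒inv₃ inv = record
    { hasInput  = hasInput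
    ; slotTable = slotTable
    ; index₃    = index₃
    ; power     = power
    ; query     = trans query (trans (cong ((header ++ concat (tabulate externalVertices)) ++_)
        (prefix-all internalVertices))
        (sym (List.++-identityʳ _)))
    }
    where open Inv₂ inv

  inv₃-query : ∀ {s} → Inv₃ #V s → State.query s ≡ encodeMap map′
  inv₃-query inv = trans query (trans
    (cong (((header ++ concat (tabulate externalVertices)) ++ concat (tabulate internalVertices))
        ++_) (prefix-all orderings))
    (sym encodeMap-map′))
    where open Inv₃ inv

  loop₁ : ∀ {s} → Inv₁ 0 s →
    ∃[ s′ ] (O ⊢ while endsCondition endsBody , s ⇓ s′
      within loopTime (price endsCondition) (endsBodyTime L) L (#E * 2)) × Inv₁ (#E * 2) s′
  loop₁ = while-within 1≤L Inv₁ (#E * 2) (endsBodyTime L)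
    (λ inv → fits (Inv₁.hasInput inv))
    (λ inv → cong₂ (λ e i → e * 2 ∸ i) (inputArray (Inv₁.hasInput inv) 1) (Inv₁.index₁ inv))
    (λ j<N → below {P = λ j → ∀ {μ q} → Inv₁ j ⟨ μ , q ⟩ →
      ∃[ s ] (O ⊢ endsBody , ⟨ μ , q ⟩ ⇓ s within endsBodyTime L) × Inv₁ (suc j) s} step₁ j<N)

  loop₂ : ∀ {s} → Inv₂ 0 s →
    ∃[ s′ ] (O ⊢ while internalCondition internalBody , s ⇓ s′
      within loopTime (price internalCondition) (internalBodyTime L) L #V) × Inv₂ #V s′
  loop₂ = while-within 1≤L Inv₂ #V (internalBodyTime L)
    (λ inv → fits (Inv₂.hasInput inv))
    (λ inv → cong₂ _∸_ (inputArray (Inv₂.hasInput inv) 0) (Inv₂.index₂ inv))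
    (λ j<N → below {P = λ j → ∀ {μ q} → Inv₂ j ⟨ μ , q ⟩ →
      ∃[ s ] (O ⊢ internalBody , ⟨ μ , q ⟩ ⇓ s within internalBodyTime L) ×
          Inv₂ (suc j) s} step₂ j<N)

  loop₃ : ∀ {s} → Inv₃ 0 s →
    ∃[ s′ ] (O ⊢ while orderingsCondition orderingsBody , s ⇓ s′
      within loopTime (price orderingsCondition) (orderingsBodyTime L) L #V) × Inv₃ #V s′
  loop₃ = while-within 1≤L Inv₃ #V (orderingsBodyTime L)
    (λ inv → fits (Inv₃.hasInput inv))
    (λ inv → cong₂ _∸_ (inputArray (Inv₃.hasInput inv) 0) (Inv₃.index₃ inv))
    (λ j<N → below {P = λ j → ∀ {μ q} → Inv₃ j ⟨ μ , q ⟩ →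
      ∃[ s ] (O ⊢ orderingsBody , ⟨ μ , q ⟩ ⇓ s within orderingsBodyTime L) ×
          Inv₃ (suc j) s} step₃ j<N)

  weaken : ∀ {p s s′ b b′} → b ≤ b′ → O ⊢ p , s ⇓ s′ within b → O ⊢ p , s ⇓ s′ within b′
  weaken b≤ (t , run , t≤) = t , run , ℕ.≤-trans t≤ b≤

  loopTime-mono : ∀ c b {N n} → N ≤ n → loopTime c b L N ≤ loopTime c b L n
  loopTime-mono c b N≤n = ℕ.+-monoˡ-≤ (c * L) (ℕ.*-monoˡ-≤ (c * L + b) N≤n)

  build : ∀ {n} → #E * 2 ≤ n → #V ≤ n →
    ∃[ s ] (O ⊢ buildQuery , initial input ⇓ s within buildTime L n) × Inv₃ #V s
  build E≤n V≤n =
    let s₁ , run₁ , inv₁ = loop₁ inv₁-initial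
        s₂ , run₂ , inv₂ = loop₂ (inv₁⇒inv₂ inv₁)
        s₃ , run₃ , inv₃ = loop₃ (inv₂⇒inv₃ inv₂)
    in s₃
     , ( emits-within 1≤L headerEmits (fits initial-hasInput)
       then set-within 1≤L {i = lit 0} {e = lit 1} (fits initial-hasInput)
       then weaken (loopTime-mono (price endsCondition) (endsBodyTime L) E≤n) run₁
       then weaken (loopTime-mono (price internalCondition) (internalBodyTime L) V≤n) run₂
       then weaken (loopTime-mono (price orderingsCondition) (orderingsBodyTime L) V≤n) run₃)
     , inv₃

  finish : ∀ {μ q b} → Inv₃ #V ⟨ μ , q ⟩ → ‖ q ‖* ≤ b → O q ≡ #ATrails map′ →
    ∃[ s ] (O ⊢ ask 8 (lit 0) ⨾ set 1 (lit 0) quotientExpr , ⟨ μ , q ⟩ ⇓ s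
             within ((1 + b + (1 + L)) + setPrice (lit 0) quotientExpr * L))
      × output s ≡ #EulerianTours G
  finish {μ} {q} {b} inv q≤b answer =
    _ , asked then set-within 1≤L {i = lit 0} {e = quotientExpr} (fits has) , (begin
      ⟦ div ⟧ (O q) (μ 7 0)                            ≡⟨ cong₂ ⟦ div ⟧
          (trans answer (Counting.#ATrails-map′ slots)) power ⟩
      ⟦ div ⟧ (#EulerianTours G * 2 ^ #V) (2 ^ #V)     ≡⟨ div-cancel (#EulerianTours G)
          (2 ^ #V) {{ℕ.m^n≢0 2 #V}} ⟩
      #EulerianTours G                                 ∎)
    where
    open ≡-Reasoning
    open Inv₃ inv
    answer≤ : O q ≤ 2 ^ L
    answer≤ = ℕ.≤-trans (ℕ.≤-reflexive answer) answer-fits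
    has : HasInput (write 8 0 (O q) μ)
    has = hasInput-write 7 0 (O q) answer≤ hasInput
    asked : O ⊢ ask 8 (lit 0) , ⟨ μ , q ⟩ ⇓ ⟨ write 8 0 (O q) μ , [] ⟩ within (1 + b + (1 + L))
    asked = _ , ⇓ask , ℕ.+-mono-≤ (ℕ.+-monoʳ-≤ 1 q≤b) (digits-≤ answer≤)

  correct : ∀ {n} → #E * 2 ≤ n → #V ≤ n → O Solves ATrailsIn4RegularMaps →
    ∃[ s ] (O ⊢ reduction , initial input ⇓ s within
        (buildTime L n + ((1 + buildTime L n + (1 + L)) + setPrice (lit 0) quotientExpr * L)))
      × output s ≡ #EulerianTours G
  correct {n} E≤n V≤n solves =
    let s , built , inv = build E≤n V≤n
        t , run , t≤ = built
        answer = trans (cong O (inv₃-query inv)) (solves (map′ , regular′))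
        s′ , finished , out = finish inv (ℕ.≤-trans (query≤time run) t≤) answer
    in s′ , built then finished , out

theorem3 : EulerianToursIn4RegularGraphs ≤ᵖᵀ ATrailsIn4RegularMaps
theorem3 = reduction , totalTime , polynomiallyBounded poly-total , λ O solves (G , regular) →
  let E≤n = ends≤digits G regular
      V≤n = ℕ.≤-trans (ℕ.m≤m*n (Graph.#V G) 4) (ℕ.≤-trans (slots≤ends G regular) E≤n)
      s , (t , run , t≤) , out = Run.correct O G regular
          (wordBound G regular ‖ encodeGraph G ‖* E≤n) E≤n V≤n solves
  in s , t , run , t≤ , out
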